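{- For all positive integers $k$, $d$ and any graph $G$ of tree-depth $d$, we have $f_k(G) \leq (2k)^{d}$. If $d\geq k+1$, then $f_k(G) \leq (2k)^{k+1}\binom{d}{k+1}$. Moreover, $f_1(G)\leq \binom{d}{2}$.
   Context: All graphs are simple, finite and undirected. An induced forest in $G$ is an acyclic induced subgraph of $G$. For $k\geq 1$, a $k$-strong forest of $G$ is an induced forest in $G$ each of whose connected components has at least $k$ edges. An edge of $G$ is $k$-valid if it is contained in some $k$-strong forest of $G$. The $k$-strong induced arboricity $f_k(G)$ is the smallest number of $k$-strong forests of $G$ that together cover all $k$-valid edges of $G$ (so $f_k(G)=0$ if $G$ has no $k$-valid edges). The transitive closure of a rooted tree $T$ with root $r$ is the graph obtained from $T$ by adding every edge $uv$ such that $v$ lies on the $u$-$r$-path of $T$. A rooted tree has depth $d$ if the largest number of vertices on a path to the root is $d$. The tree-depth of a graph $G$ is the smallest integer $d$ such that each connected component of $G$ is a subgraph of the transitive closure of a rooted tree of depth $d$. -}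

module Defs where

open import Data.Fin using (Fin; zero; suc)
open import Data.Fin.Properties using (any?; all?; injective⇒≤; _<?_; _≟_)
open import Data.Fin.Subset using (Subset; _∈_; _∩_)
open import Data.Fin.Subset.Properties using (_∈?_; anySubset?; x∈p∩q⁺)
open import Data.List using (List; []; _∷_; allFin; cartesianProduct; filter; head; last; length; lookup)
open import Data.List.Membership.Propositional using () renaming (_∈_ to _∈ˡ_)
open import Data.List.Membership.Propositional.Properties using (∈-lookup; ∈-allFin; ∈-cartesianProduct⁺)
import Data.List.Membership.DecPropositional as DecMembership
open import Data.List.Relation.Unary.All as All using (All)
open import Data.List.Relation.Unary.Any using (here; there)
open import Data.List.Relation.Unary.AllPairs using (_∷_)
open import Data.List.Relation.Unary.Linked using (Linked; linked?)
open import Data.List.Relation.Unary.Unique.Propositional using (Unique)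
import Data.List.Relation.Unary.Unique.DecPropositional as DecUnique
open import Data.Maybe using (just)
import Data.Maybe.Properties as Maybe
open import Data.Nat using (ℕ; zero; suc; _≤_; z≤n; s≤s; _≤?_)
open import Data.Product using (Σ; ∃; ∃₂; ∃-syntax; _×_; _,_; proj₁; proj₂; uncurry)
open import Data.Sum using (_⊎_; inj₁; inj₂; swap; [_,_]′)
open import Data.Vec using (Vec; []; _∷_)
import Data.Vec.Relation.Unary.All as VecAll
import Data.Vec.Relation.Unary.Any as VecAny
open import Function using (_∘_; _⇔_; mk⇔; Equivalence)
open import Level using (Level)
open import Relation.Binary using (Symmetric; Irreflexive)
import Relation.Binary as B
open import Relation.Binary.PropositionalEquality using (_≡_; _≢_; refl; sym; cong)
open import Relation.Nullary using (¬_; Dec; yes; no; contradiction)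
open import Relation.Nullary.Decidable using (map′; ¬?; _×-dec_; _⊎-dec_; _→-dec_; decidable-stable)
open import Relation.Unary using (Pred; Decidable)

private variable
  ℓ ℓ′ : Level
  n m : ℕ

IsMinimum : Pred ℕ ℓ → Pred ℕ ℓ
IsMinimum P m = P m × (∀ j → P j → m ≤ j)

IsMaximum : Pred ℕ ℓ → Pred ℕ ℓ
IsMaximum P m = P m × (∀ j → P j → j ≤ m)

minimum : {P : Pred ℕ ℓ} → Decidable P → ∃ P → ∃ (IsMinimum P)
minimum {P = P} P? (m , pm) = go P P? m pm
  where
  go : ∀ (Q : Pred ℕ _) → Decidable Q → ∀ m → Q m → ∃ (IsMinimum Q)
  go Q Q? zero    q = zero , q , λ _ _ → z≤n
  go Q Q? (suc m) q with Q? zero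
  ... | yes q₀ = zero , q₀ , λ _ _ → z≤n
  ... | no ¬q₀ with go (Q ∘ suc) (Q? ∘ suc) m q
  ...   | l , ql , least = suc l , ql , λ where
    zero    q₀ → contradiction q₀ ¬q₀
    (suc j) qj → s≤s (least j qj)

infix 3 _⇔-dec_

_⇔-dec_ : {P : Set ℓ} {Q : Set ℓ′} → Dec P → Dec Q → Dec (P ⇔ Q)
P? ⇔-dec Q? = map′ (uncurry mk⇔) (λ e → Equivalence.to e , Equivalence.from e)
                   ((P? →-dec Q?) ×-dec (Q? →-dec P?))

allSubset? : {P : Pred (Subset n) ℓ} → Decidable P → Dec (∀ S → P S)
allSubset? P? = map′ (λ ¬∃¬ S → decidable-stable (P? S) (λ ¬p → ¬∃¬ (S , ¬p)))
                     (λ ∀p (S , ¬p) → ¬p (∀p S))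
                     (¬? (anySubset? (¬? ∘ P?)))

anySubsetVec? : {P : Pred (Vec (Subset n) m) ℓ} → Decidable P → Dec (∃ P)
anySubsetVec? {m = zero}  P? = map′ ([] ,_) (λ { ([] , p) → p }) (P? [])
anySubsetVec? {m = suc m} P? =
  map′ (λ (S , Ss , p) → S ∷ Ss , p) (λ { (S ∷ Ss , p) → S , Ss , p })
       (anySubset? λ S → anySubsetVec? λ Ss → P? (S ∷ Ss))

anyShortList? : ∀ b {P : Pred (List (Fin n)) ℓ} → Decidable P →
                Dec (∃[ xs ] length xs ≤ b × P xs)
anyShortList? zero    P? = map′ (λ p → [] , z≤n , p) (λ { ([] , _ , p) → p }) (P? [])
anyShortList? (suc b) P? = map′
  [ (λ p → [] , z≤n , p) , (λ (x , xs , le , p) → x ∷ xs , s≤s le , p) ]′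
  (λ { ([] , _ , p) → inj₁ p ; (x ∷ xs , s≤s le , p) → inj₂ (x , xs , le , p) })
  (P? [] ⊎-dec any? λ x → anyShortList? b (P? ∘ (x ∷_)))

Unique-lookup-injective : {A : Set ℓ} {xs : List A} → Unique xs →
                          ∀ {i j} → lookup xs i ≡ lookup xs j → i ≡ j
Unique-lookup-injective (x∉ ∷ u) {zero}  {zero}  eq = refl
Unique-lookup-injective (x∉ ∷ u) {zero}  {suc j} eq =
  contradiction eq (All.lookup x∉ (∈-lookup j))
Unique-lookup-injective (x∉ ∷ u) {suc i} {zero}  eq =
  contradiction (sym eq) (All.lookup x∉ (∈-lookup i))
Unique-lookup-injective (x∉ ∷ u) {suc i} {suc j} eq =
  cong suc (Unique-lookup-injective u eq)

Unique⇒length≤ : {xs : List (Fin n)} → Unique xs → length xs ≤ n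
Unique⇒length≤ u = injective⇒≤ (Unique-lookup-injective u)

anyUnique? : {P : Pred (List (Fin n)) ℓ} → Decidable P → (∀ {xs} → P xs → Unique xs) → Dec (∃ P)
anyUnique? {n = n} P? unique =
  map′ (λ (xs , _ , p) → xs , p) (λ (xs , p) → xs , Unique⇒length≤ (unique p) , p)
       (anyShortList? n P?)

-- The vertex set V is a subset of Fin n, so that induced subgraphs of a
-- graph again have type Graph n.
record Graph (n : ℕ) : Set₁ where
  field
    V       : Subset n
    Adj     : Fin n → Fin n → Set
    adj?    : B.Decidable Adj
    symm    : Symmetric Adj
    irrefl  : Irreflexive _≡_ Adj
    Adj⇒∈V  : ∀ {u v} → Adj u v → u ∈ V × v ∈ V

open Graph public

infixl 8 _[_]

_[_] : Graph n → Subset n → Graph n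
(G [ S ]) .V      = V G ∩ S
(G [ S ]) .Adj u v = Adj G u v × u ∈ S × v ∈ S
(G [ S ]) .adj? u v = adj? G u v ×-dec (u ∈? S ×-dec v ∈? S)
(G [ S ]) .symm (a , u∈S , v∈S) = symm G a , v∈S , u∈S
(G [ S ]) .irrefl eq (a , _) = irrefl G eq a
(G [ S ]) .Adj⇒∈V (a , u∈S , v∈S) =
  let u∈V , v∈V = Adj⇒∈V G a in x∈p∩q⁺ (u∈V , u∈S) , x∈p∩q⁺ (v∈V , v∈S)

-- Each edge is listed once, with its smaller end first.
edges : Graph n → List (Fin n × Fin n)
edges {n} G = filter (λ (u , v) → u <? v ×-dec adj? G u v)
                     (cartesianProduct (allFin n) (allFin n))

size : Graph n → ℕ
size G = length (edges G)

-- xs lists the vertices of a path of G in order, the ends being u and v.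
record IsPath (G : Graph n) (u v : Fin n) (xs : List (Fin n)) : Set where
  constructor isPath
  field
    starts : head xs ≡ just u
    ends   : last xs ≡ just v
    inV    : All (_∈ V G) xs
    linked : Linked (Adj G) xs
    unique : Unique xs

isPath? : (G : Graph n) (u v : Fin n) → Decidable (IsPath G u v)
isPath? G u v xs =
  map′ (λ (s , e , i , l , q) → isPath s e i l q)
       (λ (isPath s e i l q) → s , e , i , l , q)
       (Maybe.≡-dec _≟_ (head xs) (just u) ×-dec
        Maybe.≡-dec _≟_ (last xs) (just v) ×-dec
        All.all? (_∈? V G) xs ×-dec
        linked? (adj? G) xs ×-dec
        DecUnique.unique? _≟_ xs)

Joined : Graph n → Fin n → Fin n → Set
Joined G u v = ∃ (IsPath G u v)

joined? : (G : Graph n) → B.Decidable (Joined G)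
joined? G u v = anyUnique? (isPath? G u v) IsPath.unique

Connected : Graph n → Set
Connected G = ∀ u v → u ∈ V G → v ∈ V G → Joined G u v

-- A cycle is a path on at least three vertices together with an edge
-- joining its ends.
HasCycle : Graph n → Set
HasCycle G = ∃₂ λ u v → ∃[ xs ] IsPath G u v xs × 3 ≤ length xs × Adj G v u

Acyclic : Graph n → Set
Acyclic G = ¬ HasCycle G

acyclic? : (G : Graph n) → Dec (Acyclic G)
acyclic? G = ¬? (any? λ u → any? λ v →
  anyUnique? (λ xs → isPath? G u v xs ×-dec 3 ≤? length xs ×-dec adj? G v u)
             (IsPath.unique ∘ proj₁))

-- C is the vertex set of a connected component; the component itself is G [ C ].
IsComponent : Graph n → Subset n → Set
IsComponent G C = ∃[ v ] v ∈ V G × (∀ u → u ∈ C ⇔ Joined G v u)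

isComponent? : (G : Graph n) → Decidable (IsComponent G)
isComponent? G C = any? λ v →
  v ∈? V G ×-dec all? λ u → u ∈? C ⇔-dec joined? G v u

-- An induced forest is given by a set F inducing it; F may stick out of V G,
-- since G [ F ] has vertex set V G ∩ F.
IsStrongForest : ℕ → Graph n → Subset n → Set
IsStrongForest k G F =
  Acyclic (G [ F ]) × (∀ C → IsComponent (G [ F ]) C → k ≤ size (G [ F ] [ C ]))

isStrongForest? : ∀ k (G : Graph n) → Decidable (IsStrongForest k G)
isStrongForest? k G F = acyclic? (G [ F ]) ×-dec
  allSubset? λ C → isComponent? (G [ F ]) C →-dec k ≤? size (G [ F ] [ C ])

Valid : ℕ → Graph n → Fin n → Fin n → Set
Valid k G u v = ∃[ F ] IsStrongForest k G F × Adj (G [ F ]) u v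

valid? : ∀ k (G : Graph n) → B.Decidable (Valid k G)
valid? k G u v = anySubset? λ F → isStrongForest? k G F ×-dec adj? (G [ F ]) u v

IsCover : ℕ → (G : Graph n) → Vec (Subset n) m → Set
IsCover k G Fs =
  VecAll.All (IsStrongForest k G) Fs ×
  (∀ u v → Valid k G u v → VecAny.Any (λ F → Adj (G [ F ]) u v) Fs)

isCover? : ∀ k (G : Graph n) → Decidable (IsCover {m = m} k G)
isCover? k G Fs =
  VecAll.all? (isStrongForest? k G) Fs ×-dec
  (all? λ u → all? λ v →
    valid? k G u v →-dec VecAny.any? (λ F → adj? (G [ F ]) u v) Fs)

CoverableBy : ℕ → Graph n → ℕ → Set
CoverableBy {n} k G m = ∃ λ (Fs : Vec (Subset n) m) → IsCover k G Fs

coverableBy? : ∀ k (G : Graph n) → Decidable (CoverableBy k G)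
coverableBy? k G m = anySubsetVec? (isCover? k G)

coverable : ∀ k (G : Graph n) → ∃ (CoverableBy k G)
coverable {n} k G =
  let m , Fs , strong , covers = go (cartesianProduct (allFin n) (allFin n))
  in  m , Fs , strong , λ u v → covers (∈-cartesianProduct⁺ (∈-allFin u) (∈-allFin v))
  where
  go : ∀ es → ∃₂ λ m (Fs : Vec (Subset n) m) → VecAll.All (IsStrongForest k G) Fs ×
       (∀ {u v} → (u , v) ∈ˡ es → Valid k G u v → VecAny.Any (λ F → Adj (G [ F ]) u v) Fs)
  go [] = 0 , [] , VecAll.[] , λ ()
  go ((u , v) ∷ es) with go es | valid? k G u v
  ... | m , Fs , strong , covers | yes (F , F-strong , uv∈F) =
    suc m , F ∷ Fs , F-strong VecAll.∷ strong , λ where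
      (here refl) _ → VecAny.here uv∈F
      (there e∈)  w → VecAny.there (covers e∈ w)
  ... | m , Fs , strong , covers | no ¬valid =
    m , Fs , strong , λ where
      (here refl) w → contradiction w ¬valid
      (there e∈)  w → covers e∈ w

f-minimum : ∀ k (G : Graph n) → ∃ (IsMinimum (CoverableBy k G))
f-minimum k G = minimum (coverableBy? k G) (coverable k G)

-- f k G is the k-strong induced arboricity of G.
f : ℕ → Graph n → ℕ
f k G = proj₁ (f-minimum k G)

f-isMinimum : ∀ k (G : Graph n) → IsMinimum (CoverableBy k G) (f k G)
f-isMinimum k G = proj₂ (f-minimum k G)

record RootedTree (n : ℕ) : Set₁ where
  field
    tree      : Graph n
    connected : Connected tree
    acyclic   : Acyclic tree
    root      : Fin n
    root∈V    : root ∈ V tree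

  OnRootPath : Fin n → Fin n → Set
  OnRootPath u v = ∃[ xs ] IsPath tree u root xs × v ∈ˡ xs

  onRootPath? : B.Decidable OnRootPath
  onRootPath? u v = anyUnique?
    (λ xs → isPath? tree u root xs ×-dec DecMembership._∈?_ _≟_ v xs)
    (IsPath.unique ∘ proj₁)

  OnRootPath⇒∈V : ∀ {u v} → OnRootPath u v → u ∈ V tree × v ∈ V tree
  OnRootPath⇒∈V (x ∷ xs , isPath refl _ in-V _ _ , v∈xs) =
    All.lookup in-V (here refl) , All.lookup in-V v∈xs

  -- u ≢ v because every vertex lies on its own path to the root, while
  -- the closure is a simple graph.
  closure : Graph n
  closure .V = V tree
  closure .Adj u v = Adj tree u v ⊎ (u ≢ v × (OnRootPath u v ⊎ OnRootPath v u))
  closure .adj? u v =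
    adj? tree u v ⊎-dec (¬? (u ≟ v) ×-dec (onRootPath? u v ⊎-dec onRootPath? v u))
  closure .symm (inj₁ a) = inj₁ (symm tree a)
  closure .symm (inj₂ (u≢v , p)) = inj₂ (u≢v ∘ sym , swap p)
  closure .irrefl eq (inj₁ a) = irrefl tree eq a
  closure .irrefl eq (inj₂ (u≢v , _)) = u≢v eq
  closure .Adj⇒∈V (inj₁ a) = Adj⇒∈V tree a
  closure .Adj⇒∈V (inj₂ (_ , inj₁ p)) = OnRootPath⇒∈V p
  closure .Adj⇒∈V (inj₂ (_ , inj₂ p)) = let v∈V , u∈V = OnRootPath⇒∈V p in u∈V , v∈V

  HasDepth : ℕ → Set
  HasDepth = IsMaximum λ l → ∃₂ λ u xs → IsPath tree u root xs × length xs ≡ l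

open RootedTree public using (closure; HasDepth)

-- H is isomorphic to a (not necessarily induced) subgraph of K.
IsSubgraphOf : Graph n → Graph m → Set
IsSubgraphOf {n} {m} H K = Σ (Fin n → Fin m) λ φ →
  (∀ {u} → u ∈ V H → φ u ∈ V K) ×
  (∀ {u v} → u ∈ V H → v ∈ V H → φ u ≡ φ v → u ≡ v) ×
  (∀ {u v} → Adj H u v → Adj K (φ u) (φ v))

HasTreeDepth : Graph n → ℕ → Set₁
HasTreeDepth G = IsMinimum λ d →
  ∀ C → IsComponent G C →
    ∃₂ λ m (T : RootedTree m) → HasDepth T d × IsSubgraphOf (G [ C ]) (closure T)

{-# OPTIONS --safe #-}

-- Every k-valid edge e lies in an induced tree A with exactly k edges. In an
-- elimination forest of G let t be the top vertex of A and follow an induced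
-- path of A from t down to e, one level at a time: at level β the path leaves a
-- vertex s and otherwise stays in the subtree C below one vertex of level β.
-- Going to the next level, s is kept or replaced by the vertex of level β of C.
-- Call s heavy at β if at least k of the subtrees at level β contain a neighbour
-- of s. From a heavy s, one induced path into each of these subtrees gives an
-- induced tree with at least k edges, and these trees, for all s on one level,
-- form a single k-strong forest. After the last heavy pair (s , β), each step
-- leaves at most 2 (k - 1) choices, so few forests cover the edges that share
-- the levels of s and β. If no pair is heavy, then the same count bounds the
-- edges that belong to t, and A itself serves as the tree for e.
--
-- Summing up gives N(d) forests with
-- N(d + 1) = (1 + … + d) + d (k - 1) + 2 (k - 1) N(d), hence N(d) ≤ (2k)^d, and
-- N(d) is d C 2 for k = 1. For the second bound, A meets at most k + 1 levels,
-- so one may first choose k + 1 levels and discard all other vertices.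

module Submission where

open import Defs
open import Data.Bool using (true)
import Data.Bool.Properties as Bool
open import Data.Fin as Fin using (Fin; suc; toℕ; zero)
open import Data.Fin.Properties using (<-cmp; _<?_; _≟_; any?; injective⇒≤; toℕ-injective)
open import Data.Fin.Subset using (Subset; _∈_; _∉_)
open import Data.Fin.Subset.Properties using (_∈?_; x∈p∩q⁺; x∈p∩q⁻)
open import Data.List using
  (List; []; _++_; _∷_; allFin; cartesianProduct; concatMap; deduplicate; downFrom; drop;
  filter; head; last; length; lookup; map; take)
  renaming (reverse to reverseˡ)
import Data.List.Membership.DecPropositional as DecMembership
open import Data.List.Membership.Propositional using
  (find; lose)
  renaming (_∈_ to _∈ˡ_; _∉_ to _∉ˡ_)
open import Data.List.Membership.Propositional.Properties using
  (∈-++⁺ʳ; ∈-++⁺ˡ; ∈-++⁻; ∈-allFin; ∈-cartesianProduct⁺; ∈-concatMap⁺; ∈-deduplicate⁺;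
  ∈-deduplicate⁻; ∈-downFrom⁺; ∈-filter⁺; ∈-filter⁻; ∈-lookup; ∈-map⁺; ∈-map⁻)
open import Data.List.Properties as List using
  (++-identityʳ; filter-accept; filter-reject; length-++; length-downFrom; length-filter;
  length-map; length-reverse; map-++; map-injective; reverse-++; reverse-injective; take-all;
  ∷-injective; ∷-injectiveˡ)
open import Data.List.Relation.Unary.All as All using (All; []; _∷_)
import Data.List.Relation.Unary.All.Properties as All
open import Data.List.Relation.Unary.AllPairs as AllPairs using (AllPairs; []; _∷_)
open import Data.List.Relation.Unary.Any as Any using (Any; here; index; there)
open import Data.List.Relation.Unary.Any.Properties as Any using (lookup-index)
open import Data.List.Relation.Unary.Linked as Linked using (Linked; [-]; []; _∷_)
open import Data.List.Relation.Unary.Unique.DecPropositional.Properties using (deduplicate-!)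
open import Data.List.Relation.Unary.Unique.Propositional using (Unique)
import Data.List.Relation.Unary.Unique.Propositional.Properties as Unique
open import Data.Maybe using (just)
open import Data.Maybe.Properties as Maybe using (just-injective)
open import Data.Nat using
  (_*_; _+_; _<_; _>_; _^_; _∸_; _≤?_; _≤_; _≤′_; suc; s≤s; zero; z≤n; ℕ; ≤′-refl; ≤′-step)
open import Data.Nat.Combinatorics using (_C_; k>n⇒nCk≡0; nC1≡n; nCk+nC[k+1]≡[n+1]C[k+1])
open import Data.Nat.Properties as ℕ using
  (*-monoˡ-≤; +-mono-≤; <-asym; <-irrefl; <⇒≢; <⇒≤; m≤m+n; m≤n⇒m<n∨m≡n; n≤1+n; suc-injective;
  ≤-<-trans; ≤-pred; ≤-refl; ≤-reflexive; ≤-trans; ≤⇒≤′; ≤∧≢⇒<; ≰⇒>)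
open import Data.Nat.Tactic.RingSolver using (solve-∀)
open import Data.Product as Product using (_,_; _×_; proj₁; proj₂; ∃; ∃-syntax; ∃₂)
import Data.Product.Properties as Product
open import Data.Sum using (_⊎_; inj₁; inj₂)
open import Data.Vec using (tabulate)
import Data.Vec.Base as Vec
open import Data.Vec.Properties as Vec using
  ([]=⇒lookup; lookup⇒[]=; lookup∘tabulate; tabulate-cong)
import Data.Vec.Relation.Unary.All as VecAll
import Data.Vec.Relation.Unary.Any as VecAny
open import Function using (Equivalence; _∘_; case_of_; id; mk⇔)
open import Level using (Level)
open import Relation.Binary using (DecidableEquality; tri<; tri>; tri≈)
open import Relation.Binary.Construct.Closure.ReflexiveTransitive using
  (Star; _◅_; _◅◅_; reverse; ε)
open import Relation.Binary.PropositionalEquality using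
  (_≡_; _≢_; cong; cong₂; refl; subst; sym; trans)
open import Relation.Nullary using (Dec; contradiction; does; no; yes; ¬_)
open import Relation.Nullary.Decidable using
  (_×-dec_; _→-dec_; _⊎-dec_; decidable-stable; does-⇔; map′; recompute; ¬?)
open import Relation.Unary using (Decidable; Pred)

private variable
  ℓ : Level
  n : ℕ
  A B : Set ℓ

-- Decidable subsets and duplicate-free lists

⟪_⟫ : {P : Pred (Fin n) ℓ} → Decidable P → Subset n
⟪ P? ⟫ = tabulate (does ∘ P?)

∈-⟪⟫⁺ : {P : Pred (Fin n) ℓ} (P? : Decidable P) → ∀ {x} → P x → x ∈ ⟪ P? ⟫
∈-⟪⟫⁺ P? {x} px = lookup⇒[]= x _ (trans (lookup∘tabulate _ x) (holds (P? x)))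
  where
  holds : (d : Dec _) → does d ≡ true
  holds (yes _) = refl
  holds (no ¬p) = contradiction px ¬p

∈-⟪⟫⁻ : {P : Pred (Fin n) ℓ} (P? : Decidable P) → ∀ {x} → x ∈ ⟪ P? ⟫ → P x
∈-⟪⟫⁻ P? {x} x∈ = holds (P? x) (trans (sym (lookup∘tabulate _ x)) ([]=⇒lookup x∈))
  where
  holds : (d : Dec _) → does d ≡ true → _
  holds (yes p) _ = p
  holds (no _) ()

Unique-⊆⇒length≤ : {xs ys : List A} → Unique xs → (∀ {x} → x ∈ˡ xs → x ∈ˡ ys) →
                   length xs ≤ length ys
Unique-⊆⇒length≤ {xs = xs} {ys} u xs⊆ys = injective⇒≤ {f = position} position-injective
  where
  position : Fin (length xs) → Fin (length ys)
  position i = index (xs⊆ys (∈-lookup i))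

  position-injective : ∀ {i j} → position i ≡ position j → i ≡ j
  position-injective {i} {j} eq = Unique-lookup-injective u
    (trans (lookup-index (xs⊆ys (∈-lookup i)))
    (trans (cong (lookup ys) eq) (sym (lookup-index (xs⊆ys (∈-lookup j))))))

∉⇒All≢ : {x : A} {xs : List A} → x ∉ˡ xs → All (x ≢_) xs
∉⇒All≢ x∉xs = All.tabulate λ y∈xs x≡y → x∉xs (subst (_∈ˡ _) (sym x≡y) y∈xs)

All≢⇒∉ : {x : A} {xs : List A} → All (x ≢_) xs → x ∉ˡ xs
All≢⇒∉ x≢ x∈xs = All.lookup x≢ x∈xs refl

last-∈ : {x : A} (xs : List A) → last xs ≡ just x → x ∈ˡ xs
last-∈ (y ∷ [])     refl = here refl
last-∈ (y ∷ z ∷ xs) eq   = there (last-∈ (z ∷ xs) eq)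

-- Walks and paths

-- Walks concatenate and reverse freely, unlike the duplicate-free lists of `IsPath`; `walk⇒path`
-- leads back.
Walk : Graph n → Fin n → Fin n → Set
Walk G = Star (Adj G)

walk-sym : (G : Graph n) → ∀ {u v} → Walk G u v → Walk G v u
walk-sym G = reverse (symm G)

∈-induced : (G : Graph n) {F : Subset n} → ∀ {x} → x ∈ V (G [ F ]) → x ∈ V G × x ∈ F
∈-induced G {F} = x∈p∩q⁻ (V G) F

path-tail : ∀ {G : Graph n} {x y v ys} → IsPath G x v (x ∷ y ∷ ys) → IsPath G y v (y ∷ ys)
path-tail (isPath _ e (_ ∷ i) (_ ∷ l) (_ ∷ q)) = isPath refl e i l q

path-∷ : ∀ {G : Graph n} {x y v xs} → Adj G x y → x ∉ˡ xs → IsPath G y v xs →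
         IsPath G x v (x ∷ xs)
path-∷ {G = G} {xs = _ ∷ _} a x∉ (isPath refl e i l q) =
  isPath refl e (proj₁ (Adj⇒∈V G a) ∷ i) (a ∷ l) (∉⇒All≢ x∉ ∷ q)

path-suffix : ∀ {G : Graph n} {x u v xs} → IsPath G x v xs → u ∈ˡ xs →
              ∃₂ λ pre ys → xs ≡ pre ++ ys × IsPath G u v ys
path-suffix {xs = x ∷ xs} p@(isPath refl _ _ _ _) (here refl) = [] , x ∷ xs , refl , p
path-suffix {xs = x ∷ y ∷ ys} p@(isPath refl _ _ _ _) (there u∈) =
  let pre , zs , eq , q = path-suffix (path-tail p) u∈ in x ∷ pre , zs , cong (x ∷_) eq , q

-- If `u` recurs on the path found for the rest of the walk, then the suffix from `u` on is taken
-- instead.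
walk⇒path : (G : Graph n) → ∀ {u v} → u ∈ V G → Walk G u v → Joined G u v
walk⇒path G {u} u∈ ε = u ∷ [] , isPath refl refl (u∈ ∷ []) [-] ([] ∷ [])
walk⇒path G {u} u∈ (a ◅ w) with walk⇒path G (proj₂ (Adj⇒∈V G a)) w
... | xs , p with Any.any? (u ≟_) xs
...   | yes u∈xs = let _ , ys , _ , q = path-suffix p u∈xs in ys , q
...   | no  u∉xs = u ∷ xs , path-∷ a u∉xs p

path⇒walk : ∀ {G : Graph n} {u v xs} → IsPath G u v xs → Walk G u v
path⇒walk {xs = x ∷ []}     (isPath refl refl _ _ _) = ε
path⇒walk {xs = x ∷ y ∷ ys} p@(isPath refl _ _ (a ∷ _) _) = a ◅ path⇒walk (path-tail p)

walk-closed : (G : Graph n) {P : Pred (Fin n) ℓ} → (∀ {x y} → Adj G x y → P x → P y) →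
              ∀ {u v} → Walk G u v → P u → P v
walk-closed G step ε pu = pu
walk-closed G step (a ◅ w) pu = walk-closed G step w (step a pu)

path-induced⁻ : (G : Graph n) {S : Subset n} → ∀ {u v xs} → IsPath (G [ S ]) u v xs →
                IsPath G u v xs × All (_∈ S) xs
path-induced⁻ G {S} (isPath s e i l q) =
  isPath s e (All.map (proj₁ ∘ ∈-induced G {S}) i) (Linked.map proj₁ l) q ,
  All.map (proj₂ ∘ ∈-induced G {S}) i

path-long : ∀ {G : Graph n} {u v xs} → IsPath G u v xs → u ≢ v → 2 ≤ length xs
path-long {xs = x ∷ []}    (isPath refl refl _ _ _) u≢v = contradiction refl u≢v
path-long {xs = x ∷ y ∷ _} _ _ = s≤s (s≤s z≤n)

-- Cycles and cores

-- A path from `p` to `q` inside `S` misses `z` and has at least two vertices, so `z` closes it to a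
-- cycle.
detour⇒cycle : (G : Graph n) (S : Subset n) → ∀ {z p q} → z ∉ S → Adj G z p → Adj G z q →
               p ≢ q → p ∈ S → Walk (G [ S ]) p q → HasCycle G
detour⇒cycle G S {z} {p} {q} z∉S zp zq p≢q p∈S w
  with walk⇒path (G [ S ]) (x∈p∩q⁺ (proj₂ (Adj⇒∈V G zp) , p∈S)) w
... | xs , π with path-induced⁻ G {S} π
...   | π′ , xs⊆S =
  z , q , z ∷ xs , path-∷ zp (λ z∈xs → z∉S (All.lookup xs⊆S z∈xs)) π′ ,
  s≤s (path-long π′ p≢q) , symm G zq

-- A set inducing minimum degree at least two. Excluding nonempty cores proves acyclicity without
-- handling cycles as lists.
Core : Graph n → Pred (Fin n) ℓ → Set ℓ
Core G Z = ∀ {x} → Z x → ∃₂ λ p q → p ≢ q × (Adj G x p × Z p) × (Adj G x q × Z q)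

-- The two neighbours of a vertex along the cycle differ because the cycle has at least three
-- vertices.
cycle⇒core : (G : Graph n) → HasCycle G → ∃ λ zs → Core G (_∈ˡ zs) × ∃ (_∈ˡ zs)
cycle⇒core G (f , c , [] , isPath () _ _ _ _ , _)
cycle⇒core G (f , c , (_ ∷ []) , _ , s≤s () , _)
cycle⇒core G (f , c , (_ ∷ _ ∷ []) , _ , s≤s (s≤s ()) , _)
cycle⇒core {n} G (f , c , xs@(f ∷ a ∷ b ∷ zs) , isPath refl e _ (fa ∷ ab ∷ l) ((f≢a ∷ f≢) ∷ (a≢b ∷ a≢) ∷ u) , _ , cf) =
  xs , core , f , here refl
  where
  -- Here `p` precedes `y` on the cycle. The last vertex is followed by `f`, so `p` must differ from
  -- `f` when `ys` is empty.
  inner : ∀ p y ys → Linked (Adj G) (p ∷ y ∷ ys) → Unique (p ∷ y ∷ ys) → last (y ∷ ys) ≡ just c →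
          All (f ≢_) (y ∷ ys) → (ys ≡ [] → p ≢ f) → ∀ {x} → x ∈ˡ y ∷ ys →
          ∃₂ λ s t → s ≢ t × (Adj G x s × s ∈ˡ f ∷ p ∷ y ∷ ys) × (Adj G x t × t ∈ˡ f ∷ p ∷ y ∷ ys)
  inner p y [] (py ∷ _) _ refl _ p≢f (here refl) =
    p , f , p≢f refl , (symm G py , there (here refl)) , cf , here refl
  inner p y (z ∷ ys) (py ∷ yz ∷ _) ((_ ∷ p≢z ∷ _) ∷ _) _ _ _ (here refl) =
    p , z , p≢z , (symm G py , there (here refl)) , yz , there (there (there (here refl)))
  inner p y (z ∷ ys) (_ ∷ l) (_ ∷ u) e (f≢y ∷ f≢) _ (there x∈)
    with inner y z ys l u e f≢ (λ _ → f≢y ∘ sym) x∈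
  ... | s , t , s≢t , (xs , s∈) , xt , t∈ = s , t , s≢t , (xs , widen s∈) , xt , widen t∈
    where
    widen : ∀ {s} → s ∈ˡ f ∷ y ∷ z ∷ ys → s ∈ˡ f ∷ p ∷ y ∷ z ∷ ys
    widen (here eq)  = here eq
    widen (there s∈) = there (there s∈)

  core : Core G (_∈ˡ xs)
  core (here refl) =
    a , c , (λ a≡c → All.lookup (a≢b ∷ a≢) (last-∈ (b ∷ zs) e) a≡c) ,
    (fa , there (here refl)) , symm G cf , there (there (last-∈ (b ∷ zs) e))
  core (there (here refl)) =
    f , b , All.lookup f≢ (here refl) , (symm G fa , here refl) , ab , there (there (here refl))
  core (there (there x∈)) = inner a b zs (ab ∷ l) ((a≢b ∷ a≢) ∷ u) e f≢ (λ _ → f≢a ∘ sym) x∈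

-- Edges and induced trees

edges-! : (G : Graph n) → Unique (edges G)
edges-! {n} G = Unique.filter⁺ _ (Unique.cartesianProduct⁺ (Unique.allFin⁺ n) (Unique.allFin⁺ n))

∈-edges⁺ : (G : Graph n) → ∀ {x y} → x Fin.< y → Adj G x y → (x , y) ∈ˡ edges G
∈-edges⁺ G x<y a = ∈-filter⁺ _ (∈-cartesianProduct⁺ (∈-allFin _) (∈-allFin _)) (x<y , a)

∈-edges⁻ : (G : Graph n) → ∀ {x y} → (x , y) ∈ˡ edges G → x Fin.< y × Adj G x y
∈-edges⁻ {n} G e∈ = proj₂ (∈-filter⁻ (λ (u , v) → u <? v ×-dec adj? G u v)
                      {xs = cartesianProduct (allFin n) (allFin n)} e∈)

Attached : Graph n → Fin n → List (Fin n) → Set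
Attached G z xs = Any (λ p → Adj G z p × All (λ q → Adj G z q → q ≡ p) xs) xs

-- An induced tree containing the edge uv, listed in reverse order of a
-- construction that starts from uv and adds one leaf at a time.
data Grown (G : Graph n) (u v : Fin n) : List (Fin n) → Set where
  base : Adj G u v → Grown G u v (v ∷ u ∷ [])
  grow : ∀ {z xs} → z ∉ˡ xs → Attached G z xs → Grown G u v xs → Grown G u v (z ∷ xs)

grown-u : ∀ {G : Graph n} {u v xs} → Grown G u v xs → u ∈ˡ xs
grown-u (base _)     = there (here refl)
grown-u (grow _ _ t) = there (grown-u t)

grown-v : ∀ {G : Graph n} {u v xs} → Grown G u v xs → v ∈ˡ xs
grown-v (base _)     = here refl
grown-v (grow _ _ t) = there (grown-v t)

grown-! : ∀ {G : Graph n} {u v xs} → Grown G u v xs → Unique xs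
grown-! {G = G} (base uv) = ((λ v≡u → irrefl G (sym v≡u) uv) ∷ []) ∷ [] ∷ []
grown-! (grow z∉ _ t)     = ∉⇒All≢ z∉ ∷ grown-! t

grown-∈V : ∀ {G : Graph n} {u v xs} → Grown G u v xs → All (_∈ V G) xs
grown-∈V {G = G} (base uv) = let u∈ , v∈ = Adj⇒∈V G uv in v∈ ∷ u∈ ∷ []
grown-∈V {G = G} (grow _ att t) = proj₁ (Adj⇒∈V G (proj₁ (proj₂ (Any.satisfied att)))) ∷ grown-∈V t

attached? : (G : Graph n) → ∀ z xs → Dec (Attached G z xs)
attached? G z xs = Any.any? (λ p → adj? G z p ×-dec All.all? (λ q → adj? G z q →-dec q ≟ p) xs) xs

grown? : (G : Graph n) (u v : Fin n) → Decidable (Grown G u v)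
grown? G u v [] = no λ ()
grown? G u v (z ∷ []) = no λ { (grow _ _ ()) }
grown? G u v (z ∷ y ∷ []) =
  map′ (λ { (refl , refl , uv) → base uv })
       (λ { (base uv) → refl , refl , uv ; (grow _ _ (grow _ _ ())) })
       (z ≟ v ×-dec y ≟ u ×-dec adj? G u v)
grown? G u v (z ∷ xs@(_ ∷ _ ∷ _)) =
  map′ (λ (z∉ , att , t) → grow z∉ att t)
       (λ { (grow z∉ att t) → z∉ , att , t })
       (¬? (z ∈ˡ? xs) ×-dec attached? G z xs ×-dec grown? G u v xs)
  where open DecMembership _≟_ using () renaming (_∈?_ to _∈ˡ?_)

grown-induced⁻ : (G : Graph n) (F : Subset n) → ∀ {u v xs} → Grown (G [ F ]) u v xs →
                 Grown G u v xs × All (_∈ F) xs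
grown-induced⁻ G F (base (uv , u∈ , v∈)) = base uv , v∈ ∷ u∈ ∷ []
grown-induced⁻ G F (grow z∉ att t) with grown-induced⁻ G F t | find att
... | t′ , xs⊆F | p , p∈ , (zp , z∈F , _) , only =
  grow z∉ (lose p∈ (zp , All.zipWith (λ (f , q∈F) zq → f (zq , z∈F , q∈F)) (only , xs⊆F))) t′ ,
  z∈F ∷ xs⊆F

grown-walk : (G : Graph n) (F : Subset n) → ∀ {u v xs} → Grown G u v xs → All (_∈ F) xs →
             ∀ {x} → x ∈ˡ xs → Walk (G [ F ]) x u
grown-walk G F (base uv) (v∈ ∷ u∈ ∷ []) (here refl) = (symm G uv , v∈ , u∈) ◅ ε
grown-walk G F (base uv) _ (there (here refl)) = ε
grown-walk G F (grow _ att t) (z∈ ∷ xs⊆F) (here refl) =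
  let p , p∈ , zp , _ = find att
  in (zp , z∈ , All.lookup xs⊆F p∈) ◅ grown-walk G F t xs⊆F p∈
grown-walk G F (grow _ _ t) (_ ∷ xs⊆F) (there x∈) = grown-walk G F t xs⊆F x∈

-- Every induced subgraph of a tree has a vertex of degree at most one: the
-- vertex that was added last.
grown-no-core : (G : Graph n) {Z : Pred (Fin n) ℓ} → ∀ {u v xs} → Grown G u v xs →
  (∀ {x} → x ∈ˡ xs → Z x → ∃₂ λ p q → p ≢ q × (Adj G x p × Z p × p ∈ˡ xs) × (Adj G x q × Z q × q ∈ˡ xs)) →
  ∀ {x} → x ∈ˡ xs → ¬ Z x
grown-no-core G (base uv) core (here refl) z with core (here refl) z
... | _ , _ , p≢q , (vp , _ , here refl) , _ = irrefl G refl vp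
... | _ , _ , p≢q , _ , (vq , _ , here refl) = irrefl G refl vq
... | _ , _ , p≢q , (_ , _ , there (here refl)) , (_ , _ , there (here refl)) = p≢q refl
grown-no-core G (base uv) core (there (here refl)) z with core (there (here refl)) z
... | _ , _ , p≢q , (vp , _ , there (here refl)) , _ = irrefl G refl vp
... | _ , _ , p≢q , _ , (vq , _ , there (here refl)) = irrefl G refl vq
... | _ , _ , p≢q , (_ , _ , here refl) , (_ , _ , here refl) = p≢q refl
grown-no-core {n} G {Z} (grow {y} {xs} y∉ att t) core = λ where
    (here refl) → ¬Zy
    (there x∈)  → grown-no-core G t smaller x∈
  where
  old : ∀ {q} → q ∈ˡ y ∷ xs → ∀ {x} → x ≢ q → x ≡ y → q ∈ˡ xs
  old (here refl) x≢q x≡y = contradiction x≡y x≢q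
  old (there q∈)  _   _   = q∈

  nbr : ∀ {q} → Adj G y q → q ∈ˡ y ∷ xs → q ∈ˡ xs
  nbr yq q∈ = old q∈ (λ y≡q → irrefl G y≡q yq) refl

  ¬Zy : ¬ Z y
  ¬Zy z with core (here refl) z | find att
  ... | p , q , p≢q , (yp , _ , p∈) , (yq , _ , q∈) | r , _ , _ , only =
    p≢q (trans (All.lookup only (nbr yp p∈) yp) (sym (All.lookup only (nbr yq q∈) yq)))

  below : ∀ {q} → Z q → q ∈ˡ y ∷ xs → q ∈ˡ xs
  below zq (here refl) = contradiction zq ¬Zy
  below zq (there q∈)  = q∈

  smaller : ∀ {x} → x ∈ˡ xs → Z x →
    ∃₂ λ p q → p ≢ q × (Adj G x p × Z p × p ∈ˡ xs) × (Adj G x q × Z q × q ∈ˡ xs)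
  smaller x∈ zx with core (there x∈) zx
  ... | p , q , p≢q , (xp , zp , p∈) , (xq , zq , q∈) =
    p , q , p≢q , (xp , zp , below zp p∈) , (xq , zq , below zq q∈)

-- Counting the edges of an induced tree

-- `edges` lists an edge with its smaller end first, while a tree meets its edges in the order of
-- growth.
orient : Fin n → Fin n → Fin n × Fin n
orient x y with x <? y
... | yes _ = x , y
... | no  _ = y , x

orient-< : ∀ {x y : Fin n} → x ≢ y → proj₁ (orient x y) Fin.< proj₂ (orient x y)
orient-< {x = x} {y} x≢y with x <? y
... | yes x<y = x<y
... | no  x≮y with <-cmp x y
...   | tri< x<y _ _ = contradiction x<y x≮y
...   | tri≈ _ x≡y _ = contradiction x≡y x≢y
...   | tri> _ _ y<x = y<x

orient-either : ∀ (x y : Fin n) → orient x y ≡ (x , y) ⊎ orient x y ≡ (y , x)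
orient-either x y with x <? y
... | yes _ = inj₁ refl
... | no  _ = inj₂ refl

orient-≡ : ∀ {x y : Fin n} → x Fin.< y → orient x y ≡ (x , y) × orient y x ≡ (x , y)
orient-≡ {x = x} {y} x<y = forward , backward
  where
  forward : orient x y ≡ (x , y)
  forward with x <? y
  ... | yes _   = refl
  ... | no  x≮y = contradiction x<y x≮y
  backward : orient y x ≡ (x , y)
  backward with y <? x
  ... | yes y<x = contradiction (≤-trans x<y (≤-trans (n≤1+n _) y<x)) (<-irrefl refl)
  ... | no  _   = refl

-- Each added leaf brings exactly one edge. `complete` bounds the size of a component from above in
-- `grow-to`; `sound` and `distinct` bound it from below in `strong-forest`.
record EdgeList (G : Graph n) (xs : List (Fin n)) : Set where
  field
    list     : List (Fin n × Fin n)
    count    : suc (length list) ≡ length xs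
    distinct : Unique list
    sound    : ∀ {x y} → (x , y) ∈ˡ list → x Fin.< y × Adj G x y × x ∈ˡ xs × y ∈ˡ xs
    complete : ∀ {x y} → x ∈ˡ xs → y ∈ˡ xs → x Fin.< y → Adj G x y → (x , y) ∈ˡ list

grown-edges : (G : Graph n) → ∀ {u v xs} → Grown G u v xs → EdgeList G xs
grown-edges G {u} {v} (base uv) = record
  { list = orient u v ∷ []
  ; count = refl
  ; distinct = [] ∷ []
  ; sound = sound
  ; complete = complete
  }
  where
  sound : ∀ {x y} → (x , y) ∈ˡ orient u v ∷ [] →
          x Fin.< y × Adj G x y × x ∈ˡ v ∷ u ∷ [] × y ∈ˡ v ∷ u ∷ []
  sound (here eq) with orient u v | orient-either u v | orient-< {x = u} {v} (λ u≡v → irrefl G u≡v uv)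
  sound (here refl) | _ | inj₁ refl | lt = lt , uv , there (here refl) , here refl
  sound (here refl) | _ | inj₂ refl | lt = lt , symm G uv , here refl , there (here refl)

  complete : ∀ {x y} → x ∈ˡ v ∷ u ∷ [] → y ∈ˡ v ∷ u ∷ [] → x Fin.< y → Adj G x y →
             (x , y) ∈ˡ orient u v ∷ []
  complete (here refl) (here refl) _ a = contradiction a (irrefl G refl)
  complete (here refl) (there (here refl)) lt _ = here (sym (proj₂ (orient-≡ lt)))
  complete (there (here refl)) (here refl) lt _ = here (sym (proj₁ (orient-≡ lt)))
  complete (there (here refl)) (there (here refl)) _ a = contradiction a (irrefl G refl)
grown-edges G (grow {z} {xs} z∉ att t) = record
  { list = orient z p ∷ list
  ; count = cong suc count
  ; distinct = ∉⇒All≢ new ∷ distinct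
  ; sound = sound′
  ; complete = complete′
  }
  where
  open EdgeList (grown-edges G t)
  p = proj₁ (find att)
  p∈ = proj₁ (proj₂ (find att))
  zp = proj₁ (proj₂ (proj₂ (find att)))
  only = proj₂ (proj₂ (proj₂ (find att)))

  new : orient z p ∉ˡ list
  new e∈ with orient z p | orient-either z p
  ... | _ | inj₁ refl = z∉ (proj₁ (proj₂ (proj₂ (sound e∈))))
  ... | _ | inj₂ refl = z∉ (proj₂ (proj₂ (proj₂ (sound e∈))))

  sound′ : ∀ {x y} → (x , y) ∈ˡ orient z p ∷ list →
           x Fin.< y × Adj G x y × x ∈ˡ z ∷ xs × y ∈ˡ z ∷ xs
  sound′ (there e∈) = let lt , a , x∈ , y∈ = sound e∈ in lt , a , there x∈ , there y∈
  sound′ (here eq) with orient z p | orient-either z p | orient-< {x = z} {p} (λ z≡p → irrefl G z≡p zp)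
  sound′ (here refl) | _ | inj₁ refl | lt = lt , zp , here refl , there p∈
  sound′ (here refl) | _ | inj₂ refl | lt = lt , symm G zp , there p∈ , here refl

  complete′ : ∀ {x y} → x ∈ˡ z ∷ xs → y ∈ˡ z ∷ xs → x Fin.< y → Adj G x y →
              (x , y) ∈ˡ orient z p ∷ list
  complete′ (here refl) (here refl) _ a = contradiction a (irrefl G refl)
  complete′ (here refl) (there y∈) lt a with All.lookup only y∈ a
  ... | refl = here (sym (proj₁ (orient-≡ lt)))
  complete′ (there x∈) (here refl) lt a with All.lookup only x∈ (symm G a)
  ... | refl = here (sym (proj₂ (orient-≡ lt)))
  complete′ (there x∈) (there y∈) lt a = there (complete x∈ y∈ lt a)

-- Trees inside strong forests, and a criterion for strong forests

joined-component : (G : Graph n) → ∀ {u} → u ∈ V G → IsComponent G ⟪ joined? G u ⟫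
joined-component G {u} u∈ = u , u∈ , λ w → mk⇔ (∈-⟪⟫⁻ (joined? G u)) (∈-⟪⟫⁺ (joined? G u))

-- While fewer than k edges have been collected, the component is not yet
-- exhausted; a second neighbour of the new vertex would close a cycle.
grow-to : (G : Graph n) → Acyclic G → ∀ {u v k} → Adj G u v →
          (∀ K → IsComponent G K → k ≤ size (G [ K ])) →
          ∀ {j} → 2 ≤′ j → j ≤ suc k → ∃[ xs ] Grown G u v xs × length xs ≡ j
grow-to G acyc uv big ≤′-refl _ = _ , base uv , refl
grow-to {n} G acyc {u} {v} {k} uv big (≤′-step {j} 2≤j) j<k+1
  with grow-to G acyc uv big 2≤j (≤-trans (n≤1+n _) j<k+1)
... | xs , t , refl
  with any? (λ z → ¬? (Any.any? (z ≟_) xs) ×-dec Any.any? (adj? G z) xs)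
...   | no stuck = contradiction (≤-trans (big K K-comp) size≤) <-bound
  where
  K = ⟪ joined? G u ⟫
  K-comp = joined-component G (proj₁ (Adj⇒∈V G uv))
  open EdgeList (grown-edges G t)

  closed : ∀ {x y} → Adj G x y → x ∈ˡ xs → y ∈ˡ xs
  closed {x} {y} xy x∈ with Any.any? (y ≟_) xs
  ... | yes y∈ = y∈
  ... | no  y∉ = contradiction (y , y∉ , lose x∈ (symm G xy)) stuck

  K⊆xs : ∀ {x} → x ∈ K → x ∈ˡ xs
  K⊆xs x∈ = walk-closed G closed (path⇒walk (proj₂ (∈-⟪⟫⁻ (joined? G u) x∈))) (grown-u t)

  size≤ : size (G [ K ]) ≤ length list
  size≤ = Unique-⊆⇒length≤ (edges-! (G [ K ])) λ {(x , y)} e∈ →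
    let lt , xy , x∈ , y∈ = ∈-edges⁻ (G [ K ]) e∈ in complete (K⊆xs x∈) (K⊆xs y∈) lt xy

  <-bound : ¬ k ≤ length list
  <-bound k≤ = <-irrefl refl (≤-trans (≤-trans (s≤s (≤-reflexive count)) j<k+1) (s≤s k≤))
...   | yes (z , z∉ , adjacent) with find adjacent
...     | p , p∈ , zp = z ∷ xs , grow z∉ (lose p∈ (zp , All.tabulate only)) t , refl
  where
  S = ⟪ (λ x → Any.any? (x ≟_) xs) ⟫

  xs⊆S : All (_∈ S) xs
  xs⊆S = All.tabulate (∈-⟪⟫⁺ (λ x → Any.any? (x ≟_) xs))

  only : ∀ {q} → q ∈ˡ xs → Adj G z q → q ≡ p
  only {q} q∈ zq with q ≟ p
  ... | yes q≡p = q≡p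
  ... | no  q≢p = contradiction
    (detour⇒cycle G S (z∉ ∘ ∈-⟪⟫⁻ (λ x → Any.any? (x ≟_) xs)) zq zp q≢p (All.lookup xs⊆S q∈)
      (grown-walk G S t xs⊆S q∈ ◅◅ walk-sym (G [ S ]) (grown-walk G S t xs⊆S p∈)))
    acyc

-- The tree is cut down to exactly `k` edges, so that it meets at most `suc k` levels of an
-- elimination forest.
valid⇒grown : (G : Graph n) → ∀ {k u v} → 1 ≤ k → Valid k G u v →
              ∃[ xs ] Grown G u v xs × length xs ≡ suc k
valid⇒grown G 1≤k (F , (acyc , big) , uv) =
  let xs , t , len = grow-to (G [ F ]) acyc uv big (≤⇒≤′ (s≤s 1≤k)) ≤-refl
  in xs , proj₁ (grown-induced⁻ G F t) , len

-- A cycle of `G [ F ]` would yield a nonempty core in `F`. The walk from a vertex to its tree puts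
-- the whole tree into the component of that vertex, which thus has at least `k` edges.
strong-forest : (G : Graph n) (F : Subset n) → ∀ {k} →
  (∀ {Z : Fin n → Set} → (∀ {x} → Z x → x ∈ F) → Core G Z → ∀ {x} → ¬ Z x) →
  (∀ {x} → x ∈ F → ∃₂ λ u v → ∃[ xs ] Grown G u v xs × suc k ≤ length xs ×
                   All (_∈ F) xs × Walk (G [ F ]) x u) →
  IsStrongForest k G F
strong-forest {n} G F {k} no-core tree = acyclic , big
  where
  acyclic : Acyclic (G [ F ])
  acyclic cyc with cycle⇒core (G [ F ]) cyc
  ... | zs , core , _ , z∈ = no-core (λ x∈ → proj₁ (proj₂ (in-F x∈)))
      (λ x∈ → let p , q , p≢q , ((xp , _) , p∈) , ((xq , _) , q∈) = core x∈
              in p , q , p≢q , (xp , p∈) , (xq , q∈)) z∈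
    where
    in-F : ∀ {x} → x ∈ˡ zs → ∃ λ p → x ∈ F × p ∈ F
    in-F x∈ = let p , _ , _ , ((_ , x∈F , p∈F) , _) , _ = core x∈ in p , x∈F , p∈F

  big : ∀ K → IsComponent (G [ F ]) K → k ≤ size (G [ F ] [ K ])
  big K (x , x∈V , K⇔) with tree (proj₂ (∈-induced G {F} x∈V))
  ... | u , v , xs , t , k<len , xs⊆F , w =
    ≤-trans (≤-pred (≤-trans k<len (≤-reflexive (sym count))))
      (Unique-⊆⇒length≤ distinct λ {(a , b)} e∈ →
        let lt , ab , a∈ , b∈ = sound e∈
        in ∈-edges⁺ (G [ F ] [ K ]) lt
             ((ab , All.lookup xs⊆F a∈ , All.lookup xs⊆F b∈) , in-K a∈ , in-K b∈))
    where
    open EdgeList (grown-edges G t)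

    in-K : ∀ {a} → a ∈ˡ xs → a ∈ K
    in-K a∈ = Equivalence.from (K⇔ _) (walk⇒path (G [ F ]) x∈V
      (w ◅◅ walk-sym (G [ F ]) (grown-walk G F t xs⊆F a∈)))

-- Induced paths towards an edge

-- Induced paths that end with the edge uv, traversed in either direction.
data PathTo (G : Graph n) (u v : Fin n) : List (Fin n) → Set where
  forth : Adj G u v → PathTo G u v (u ∷ v ∷ [])
  back  : Adj G u v → PathTo G u v (v ∷ u ∷ [])
  step  : ∀ {x y zs} → Adj G x y → All (λ z → ¬ Adj G x z) zs → x ∉ˡ y ∷ zs →
         PathTo G u v (y ∷ zs) → PathTo G u v (x ∷ y ∷ zs)

module _ {G : Graph n} {u v : Fin n} where

  pathTo-edge : ∀ {xs} → PathTo G u v xs → Adj G u v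
  pathTo-edge (forth a)         = a
  pathTo-edge (back a)         = a
  pathTo-edge (step _ _ _ p) = pathTo-edge p

  pathTo-! : ∀ {xs} → PathTo G u v xs → Unique xs
  pathTo-! (forth a)          = ((λ u≡v → irrefl G u≡v a) ∷ []) ∷ [] ∷ []
  pathTo-! (back a)          = ((λ v≡u → irrefl G (sym v≡u) a) ∷ []) ∷ [] ∷ []
  pathTo-! (step _ _ x∉ p) = ∉⇒All≢ x∉ ∷ pathTo-! p

  pathTo-u : ∀ {xs} → PathTo G u v xs → u ∈ˡ xs
  pathTo-u (forth _)         = here refl
  pathTo-u (back _)         = there (here refl)
  pathTo-u (step _ _ _ p) = there (pathTo-u p)

  pathTo-v : ∀ {xs} → PathTo G u v xs → v ∈ˡ xs
  pathTo-v (forth _)         = there (here refl)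
  pathTo-v (back _)         = here refl
  pathTo-v (step _ _ _ p) = there (pathTo-v p)

  pathTo-linked : ∀ {xs} → PathTo G u v xs → Linked (Adj G) xs
  pathTo-linked (forth a)         = a ∷ [-]
  pathTo-linked (back a)         = symm G a ∷ [-]
  pathTo-linked (step a _ _ p) = a ∷ pathTo-linked p

  pathTo-next : ∀ {x xs} → PathTo G u v (x ∷ xs) → ∃ λ y → y ∈ˡ xs × Adj G x y
  pathTo-next (forth a)         = _ , here refl , a
  pathTo-next (back a)         = _ , here refl , symm G a
  pathTo-next (step a _ _ _) = _ , here refl , a

  -- Only `u` and `v` can fail to have the whole final edge after them.
  pathTo-suffix : ∀ {x w ys} → PathTo G u v (w ∷ ys) → x ∈ˡ w ∷ ys → x ≢ u → x ≢ v →
    ∃ λ zs → PathTo G u v (x ∷ zs) × (∀ {z} → z ∈ˡ zs → z ∈ˡ ys)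
  pathTo-suffix (forth _) (here refl) x≢u _ = contradiction refl x≢u
  pathTo-suffix (forth _) (there (here refl)) _ x≢v = contradiction refl x≢v
  pathTo-suffix (back _) (here refl) _ x≢v = contradiction refl x≢v
  pathTo-suffix (back _) (there (here refl)) x≢u _ = contradiction refl x≢u
  pathTo-suffix p@(step _ _ _ _) (here refl) _ _ = _ , p , id
  pathTo-suffix (step _ _ _ p) (there x∈) x≢u x≢v =
    let zs , q , zs⊆ = pathTo-suffix p x∈ x≢u x≢v in zs , q , there ∘ zs⊆

  -- The far end of the path has degree at most one.
  pathTo-no-core : {Z : Pred (Fin n) ℓ} → ∀ {x xs} → PathTo G u v (x ∷ xs) →
    (∀ {y} → y ∈ˡ xs → Z y →
      ∃₂ λ p q → p ≢ q × (Adj G y p × Z p × p ∈ˡ x ∷ xs) × (Adj G y q × Z q × q ∈ˡ x ∷ xs)) →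
    ∀ {y} → y ∈ˡ xs → ¬ Z y
  pathTo-no-core {Z = Z} {x} path core = go path core
    where
    leaf : ∀ {x y ys} → (∀ {p} → p ∈ˡ ys → Z p → ¬ Adj G y p) →
      ¬ ∃₂ λ p q → p ≢ q × (Adj G y p × Z p × p ∈ˡ x ∷ y ∷ ys) × (Adj G y q × Z q × q ∈ˡ x ∷ y ∷ ys)
    leaf free (p , q , p≢q , (_ , _ , here refl) , (_ , _ , here refl)) = p≢q refl
    leaf free (p , q , p≢q , (a , _ , there (here refl)) , _) = irrefl G refl a
    leaf free (p , q , p≢q , (a , z , there (there p∈)) , _) = free p∈ z a
    leaf free (p , q , p≢q , _ , (a , _ , there (here refl))) = irrefl G refl a
    leaf free (p , q , p≢q , _ , (a , z , there (there q∈))) = free q∈ z a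

    go : ∀ {x xs} → PathTo G u v (x ∷ xs) →
      (∀ {y} → y ∈ˡ xs → Z y →
        ∃₂ λ p q → p ≢ q × (Adj G y p × Z p × p ∈ˡ x ∷ xs) × (Adj G y q × Z q × q ∈ˡ x ∷ xs)) →
      ∀ {y} → y ∈ˡ xs → ¬ Z y
    go (forth _) core (here refl) zy = leaf (λ ()) (core (here refl) zy)
    go (back _) core (here refl) zy = leaf (λ ()) (core (here refl) zy)
    go {x} (step {y = y} {zs} a x≁ x∉ p) core = λ where
        (here refl) zy → leaf (λ p∈ zp _ → rest p∈ zp) (core (here refl) zy)
        (there y∈)     → rest y∈
      where
      -- The path is induced, so `x` has no neighbour beyond `y`, and a core vertex in `zs` keeps
      -- its two neighbours when `x` is dropped.
      inside : ∀ {w p} → w ∈ˡ zs → Adj G w p → p ∈ˡ x ∷ y ∷ zs → p ∈ˡ y ∷ zs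
      inside w∈ wp (here refl) = contradiction (symm G wp) (All.lookup x≁ w∈)
      inside _  _  (there p∈)  = p∈

      rest : ∀ {w} → w ∈ˡ zs → ¬ Z w
      rest = go p λ w∈ zw →
        let p , q , p≢q , (wp , zp , p∈) , (wq , zq , q∈) = core (there w∈) zw
        in p , q , p≢q , (wp , zp , inside w∈ wp p∈) , (wq , zq , inside w∈ wq q∈)

pathTo? : (G : Graph n) (u v : Fin n) → Decidable (PathTo G u v)
pathTo? G u v [] = no λ ()
pathTo? G u v (x ∷ []) = no λ ()
pathTo? G u v (x ∷ y ∷ []) = map′
  (λ { (inj₁ (refl , refl) , a) → forth a ; (inj₂ (refl , refl) , a) → back a })
  (λ { (forth a) → inj₁ (refl , refl) , a ; (back a) → inj₂ (refl , refl) , a ; (step _ _ _ ()) })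
  (((x ≟ u ×-dec y ≟ v) ⊎-dec (x ≟ v ×-dec y ≟ u)) ×-dec adj? G u v)
pathTo? G u v (x ∷ ys@(y ∷ zs@(_ ∷ _))) = map′
  (λ (a , x≁ , x∉ , p) → step a x≁ x∉ p)
  (λ { (step a x≁ x∉ p) → a , x≁ , x∉ , p })
  (adj? G x y ×-dec All.all? (λ z → ¬? (adj? G x z)) zs ×-dec ¬? (Any.any? (x ≟_) ys) ×-dec pathTo? G u v ys)

linked-walk : (G : Graph n) (F : Subset n) → ∀ {x xs} → Linked (Adj G) (x ∷ xs) → All (_∈ F) (x ∷ xs) →
              ∀ {y} → y ∈ˡ x ∷ xs → Walk (G [ F ]) y x
linked-walk G F l in-F (here refl) = ε
linked-walk G F (a ∷ l) (x∈ ∷ y∈ ∷ in-F) (there y∈xs) =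
  linked-walk G F l (y∈ ∷ in-F) y∈xs ◅◅ ((symm G a , y∈ , x∈) ◅ ε)

-- A leaf is prepended to the path of its attachment vertex. It has no other neighbour in the tree,
-- hence none later on the path.
grown-path : (G : Graph n) → ∀ {u v xs t} → Grown G u v xs → t ∈ˡ xs →
             ∃ λ ys → PathTo G u v (t ∷ ys) × All (_∈ˡ xs) (t ∷ ys)
grown-path G (base a) (here refl) = _ , back a , here refl ∷ there (here refl) ∷ []
grown-path G (base a) (there (here refl)) = _ , forth a , there (here refl) ∷ here refl ∷ []
grown-path G (grow {z} {xs} z∉ att t) (here refl) with find att
... | p , p∈ , zp , only with grown-path G t p∈
...   | ys , π , ys⊆ =
  p ∷ ys , step zp (All.tabulate avoid) (z∉ ∘ All.lookup ys⊆) π , here refl ∷ All.map there ys⊆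
  where
  avoid : ∀ {r} → r ∈ˡ ys → ¬ Adj G z r
  avoid r∈ zr = All≢⇒∉ (AllPairs.head (pathTo-! π))
    (subst (_∈ˡ ys) (All.lookup only (All.lookup ys⊆ (there r∈)) zr) r∈)
grown-path G (grow _ _ t) (there t∈) =
  let ys , π , ys⊆ = grown-path G t t∈ in ys , π , All.map there ys⊆

-- Elimination forests as layerings

-- An elimination forest of depth d for the subgraph induced by U, presented
-- by the level of each vertex and the class cls i x of vertices that share
-- with x the ancestor on level i. Here levels start at 0, and cls i x is
-- meaningful only when i does not exceed the level of x.
record Layering (G : Graph n) (U : Subset n) (d : ℕ) : Set₁ where
  field
    Label    : Set
    _≟ᴸ_     : DecidableEquality Label
    level    : Fin n → ℕ
    cls      : ℕ → Fin n → Label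
    level<   : ∀ {x} → x ∈ U → level x < d
    coarsen  : ∀ {i x y} → cls (suc i) x ≡ cls (suc i) y → cls i x ≡ cls i y
    unique   : ∀ {x y} → x ∈ U → y ∈ U → level x ≡ level y → cls (level x) x ≡ cls (level x) y → x ≡ y
    adjacent : ∀ {x y} → x ∈ U → y ∈ U → Adj G x y →
               (level x < level y × cls (level x) x ≡ cls (level x) y) ⊎
               (level y < level x × cls (level y) y ≡ cls (level y) x)

  coarsen-≤ : ∀ {i j x y} → i ≤ j → cls j x ≡ cls j y → cls i x ≡ cls i y
  coarsen-≤ i≤j = go (≤⇒≤′ i≤j)
    where
    go : ∀ {i j x y} → i ≤′ j → cls j x ≡ cls j y → cls i x ≡ cls i y
    go ≤′-refl     = id
    go (≤′-step s) = go s ∘ coarsen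

  -- One end is an ancestor of the other, so both have the same ancestors down to the level of the
  -- upper end.
  adjacent-cls : ∀ {i x y} → x ∈ U → y ∈ U → Adj G x y → i ≤ level x → i ≤ level y → cls i x ≡ cls i y
  adjacent-cls x∈ y∈ xy i≤x i≤y with adjacent x∈ y∈ xy
  ... | inj₁ (_ , eq) = coarsen-≤ i≤x eq
  ... | inj₂ (_ , eq) = sym (coarsen-≤ i≤y eq)

  adjacent-level≢ : ∀ {x y} → x ∈ U → y ∈ U → Adj G x y → level x ≢ level y
  adjacent-level≢ x∈ y∈ xy with adjacent x∈ y∈ xy
  ... | inj₁ (lt , _) = <⇒≢ lt
  ... | inj₂ (lt , _) = <⇒≢ lt ∘ sym

-- Classes and induced paths into them

-- Counts the edges reachable with `h` levels left: one edge ends on the current level, and both `s`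
-- and the vertex met there may continue into at most `k` classes each.
g : ℕ → ℕ → ℕ
g k zero    = 0
g k (suc h) = suc (k * g k h + k * g k h)

length-concatMap≤ : (f : A → List B) → ∀ {b} → (∀ x → length (f x) ≤ b) → ∀ xs →
                    length (concatMap f xs) ≤ length xs * b
length-concatMap≤ f le [] = z≤n
length-concatMap≤ f {b} le (x ∷ xs) =
  ≤-trans (≤-reflexive (length-++ (f x))) (+-mono-≤ (le x) (length-concatMap≤ f le xs))

∸-unfold : ∀ {i d} → i < d → d ∸ i ≡ suc (d ∸ suc i)
∸-unfold {zero}  (s≤s _)   = refl
∸-unfold {suc i} (s≤s i<d) = ∸-unfold i<d

module Pieces (G : Graph n) (U : Subset n) (d : ℕ) (L : Layering G U d) where
  open Layering L

  -- The bound on the level is included because `cls β x` is meaningful only from level `β` on.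
  InClass : ℕ → Label → Fin n → Set
  InClass β c x = x ∈ U × β ≤ level x × cls β x ≡ c

  inClass? : ∀ β c → Decidable (InClass β c)
  inClass? β c x = x ∈? U ×-dec β ≤? level x ×-dec cls β x ≟ᴸ c

  -- Duplicates are removed so that the length counts the subtrees on level `β` in which `s` has a
  -- neighbour.
  relevant : ℕ → Fin n → List Label
  relevant β s = deduplicate _≟ᴸ_ (map (cls β)
    (filter (λ y → y ∈? U ×-dec β ≤? level y ×-dec adj? G s y) (allFin n)))

  relevant-! : ∀ β s → Unique (relevant β s)
  relevant-! β s = deduplicate-! _≟ᴸ_ (map (cls β)
    (filter (λ y → y ∈? U ×-dec β ≤? level y ×-dec adj? G s y) (allFin n)))

  ∈-relevant⁺ : ∀ {β c s y} → InClass β c y → Adj G s y → c ∈ˡ relevant β s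
  ∈-relevant⁺ {β} (y∈ , β≤ , refl) sy =
    ∈-deduplicate⁺ _≟ᴸ_ (∈-map⁺ (cls β) (∈-filter⁺ _ (∈-allFin _) (y∈ , β≤ , sy)))

  ∈-relevant⁻ : ∀ {β c s} → c ∈ˡ relevant β s → ∃ λ y → InClass β c y × Adj G s y
  ∈-relevant⁻ {β} {c} {s} c∈ with ∈-map⁻ (cls β) (∈-deduplicate⁻ _≟ᴸ_ _ c∈)
  ... | y , y∈ , c≡ with ∈-filter⁻ (λ y → y ∈? U ×-dec β ≤? level y ×-dec adj? G s y) {xs = allFin n} y∈
  ...   | _ , y∈U , β≤ , sy = y , (y∈U , β≤ , sym c≡) , sy

  Reach : Fin n → ℕ → Label → Fin n → Fin n → Set
  Reach s β c u v = ∃ λ xs → PathTo G u v (s ∷ xs) × All (InClass β c) xs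

  reach? : ∀ s β c u v → Dec (Reach s β c u v)
  reach? s β c u v = anyUnique? (λ xs → pathTo? G u v (s ∷ xs) ×-dec All.all? (inClass? β c) xs)
                                (AllPairs.tail ∘ pathTo-! ∘ proj₁)

  reach-relevant : ∀ {s β c u v} → Reach s β c u v → c ∈ˡ relevant β s
  reach-relevant (xs , π , in-c) =
    let y , y∈ , sy = pathTo-next π in ∈-relevant⁺ (All.lookup in-c y∈) sy

  -- Adjacent vertices on levels from `i` on share their class, so a path that stays there cannot
  -- leave it.
  linked-cls : ∀ {i y ys} → Linked (Adj G) (y ∷ ys) → All (λ z → z ∈ U × i ≤ level z) (y ∷ ys) →
               All (λ z → cls i z ≡ cls i y) (y ∷ ys)
  linked-cls [-] _ = refl ∷ []
  linked-cls (a ∷ l) ((y∈ , i≤y) ∷ (z∈ , i≤z) ∷ h) =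
    refl ∷ All.map (λ eq → trans eq (sym (adjacent-cls y∈ z∈ a i≤y i≤z))) (linked-cls l ((z∈ , i≤z) ∷ h))

  linked-inClass : ∀ {i xs v} → Linked (Adj G) xs → All (λ z → z ∈ U × i ≤ level z) xs → v ∈ˡ xs →
                   All (InClass i (cls i v)) xs
  linked-inClass {i} {x ∷ xs} {v} l h v∈ = All.zipWith (λ ((z∈ , i≤z) , eq) → z∈ , i≤z , trans eq (sym v≡)) (h , same)
    where
    same = linked-cls l h
    v≡ : cls i v ≡ cls i x
    v≡ = All.lookup same v∈

  -- Passing to the class of v on the next level: if the path from s meets the
  -- vertex on level β of the current class, then it is restarted there.
  descend : ∀ {s β u v} → s ∈ U → level s < β → v ∈ U → suc β ≤ level v →
            Reach s β (cls β v) u v →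
            ∃ λ s′ → (s′ ≡ s ⊎ (InClass β (cls β v) s′ × level s′ ≡ β)) ×
                     Reach s′ (suc β) (cls (suc β) v) u v
  descend {s} {β} {u} {v} s∈ s<β v∈ β<v (xs , π , in-c)
    with Any.any? (λ x → level x ℕ.≟ β) xs
  ... | no none = s , inj₁ refl , xs , π ,
    linked-inClass (Linked.tail (pathTo-linked π)) (All.tabulate deeper) v∈xs
    where
    v∈xs : v ∈ˡ xs
    v∈xs with pathTo-v π
    ... | here refl = contradiction (≤-trans s<β (<⇒≤ β<v)) (<-irrefl refl)
    ... | there v∈  = v∈

    deeper : ∀ {z} → z ∈ˡ xs → z ∈ U × suc β ≤ level z
    deeper z∈ = let z∈U , β≤ , _ = All.lookup in-c z∈
                in z∈U , ≤∧≢⇒< β≤ (λ β≡ → none (lose z∈ (sym β≡)))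
  ... | yes some with find some
  ...   | x , x∈ , x≡β with x ≟ u
  -- The old path may end in `u`, so the edge itself becomes the new path.
  ...     | yes refl = x , inj₂ (All.lookup in-c x∈ , x≡β) , v ∷ [] , forth (pathTo-edge π) , (v∈ , β<v , refl) ∷ []
  ...     | no x≢u = x , inj₂ (All.lookup in-c x∈ , x≡β) , zs , ρ ,
    linked-inClass (Linked.tail (pathTo-linked ρ)) (All.tabulate deeper) v∈zs
    where
    x≢v : x ≢ v
    x≢v refl = <⇒≢ β<v (sym x≡β)

    suffix = pathTo-suffix π (there x∈) x≢u x≢v
    zs = proj₁ suffix
    ρ = proj₁ (proj₂ suffix)

    v∈zs : v ∈ˡ zs
    v∈zs with pathTo-v ρ
    ... | here v≡x  = contradiction (sym v≡x) x≢v
    ... | there v∈ = v∈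

    x∉zs : All (x ≢_) zs
    x∉zs = AllPairs.head (pathTo-! ρ)

    -- The class has only one vertex on level `β`, namely `x`, and the path does not return to it.
    deeper : ∀ {z} → z ∈ˡ zs → z ∈ U × suc β ≤ level z
    deeper z∈ =
      let z∈U , β≤ , z≡ = All.lookup in-c (proj₂ (proj₂ suffix) z∈)
          x∈U , _ , x≡ = All.lookup in-c x∈
      in z∈U , ≤∧≢⇒< β≤ λ β≡ → All.lookup x∉zs z∈
           (unique x∈U z∈U (trans x≡β β≡)
             (subst (λ i → cls i x ≡ cls i _) (sym x≡β) (trans x≡ (sym z≡))))

-- `head (drop j xs)` is a partial lookup, so one index `j` serves lists of different lengths.
∈⇒drop : {x : A} {xs : List A} → x ∈ˡ xs → ∃ λ j → j < length xs × head (drop j xs) ≡ just x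
∈⇒drop (here refl) = 0 , s≤s z≤n , refl
∈⇒drop (there x∈)  = let j , j< , eq = ∈⇒drop x∈ in suc j , s≤s j< , eq

lowest : (h : A → ℕ) → ∀ x xs → ∃ λ t → t ∈ˡ x ∷ xs × All (λ y → h t ≤ h y) (x ∷ xs)
lowest h x [] = x , here refl , ≤-refl ∷ []
lowest h x (y ∷ ys) with lowest h y ys
... | t , t∈ , le with ℕ.≤-total (h x) (h t)
...   | inj₁ x≤t = x , here refl , ≤-refl ∷ All.map (≤-trans x≤t) le
...   | inj₂ t≤x = t , there t∈ , t≤x ∷ le

-- The two kinds of strong forests: bouquets and groves

-- The forests are to be (suc k)-strong.
module Strong (G : Graph n) (U : Subset n) (d : ℕ) (L : Layering G U d) (k : ℕ) where
  open Layering L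
  open Pieces G U d L
  open DecMembership _≟ᴸ_ using () renaming (_∈?_ to _∈ᴸ?_)

  Heavy : ℕ → Fin n → Set
  Heavy β s = suc k ≤ length (relevant β s)

  heavy? : ∀ β s → Dec (Heavy β s)
  heavy? β s = suc k ≤? length (relevant β s)

  module Bouquet (a β : ℕ) (a<β : a < β) (piece : Fin n → Label → List (Fin n)) where

    Root : Fin n → Set
    Root s = s ∈ U × level s ≡ a × Heavy β s

    Petal : Fin n → Label → Fin n → Set
    Petal s c x = Root s × c ∈ˡ relevant β s × x ∈ˡ piece s c

    -- The class of a petal vertex `x` can only be `cls β x`, so only the root has to be searched
    -- for.
    Member : Fin n → Set
    Member x = Root x ⊎ ∃ λ s → Petal s (cls β x) x

    root? : Decidable Root
    root? s = s ∈? U ×-dec level s ℕ.≟ a ×-dec heavy? β s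

    member? : Decidable Member
    member? x = root? x ⊎-dec any? λ s →
      root? s ×-dec cls β x ∈ᴸ? relevant β s ×-dec Any.any? (x ≟_) (piece s (cls β x))

    F : Subset n
    F = ⟪ member? ⟫

    root∈F : ∀ {s} → Root s → s ∈ F
    root∈F r = ∈-⟪⟫⁺ member? (inj₁ r)

    module _ (piece-ok : ∀ {s c} → Root s → c ∈ˡ relevant β s →
                ∃₂ λ u v → PathTo G u v (s ∷ piece s c) × All (InClass β c) (piece s c)) where

      petal-class : ∀ {s c x} → Petal s c x → InClass β c x
      petal-class (r , c∈ , x∈) = let _ , _ , _ , in-c = piece-ok r c∈ in All.lookup in-c x∈

      petal∈F : ∀ {s c x} → Petal s c x → x ∈ F
      petal∈F p with petal-class p
      ... | _ , _ , refl = ∈-⟪⟫⁺ member? (inj₂ (_ , p))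

      -- The class contains a neighbour of `s` deeper than `s`, so all of it lies below `s`.
      below-root : ∀ {s c x} → Root s → c ∈ˡ relevant β s → InClass β c x → cls a s ≡ cls a x
      below-root (s∈ , s≡a , _) c∈ (_ , _ , x≡) with ∈-relevant⁻ c∈
      ... | y , (y∈ , β≤y , y≡) , sy =
        trans (adjacent-cls s∈ y∈ sy (≤-reflexive (sym s≡a)) (≤-trans (<⇒≤ a<β) β≤y))
              (coarsen-≤ (<⇒≤ a<β) (trans y≡ (sym x≡)))

      root-unique : ∀ {s t} → Root s → Root t → cls a s ≡ cls a t → s ≡ t
      root-unique (s∈ , refl , _) (t∈ , t≡a , _) eq = unique s∈ t∈ (sym t≡a) eq

      member∈U : ∀ {x} → Member x → x ∈ U
      member∈U (inj₁ (x∈ , _)) = x∈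
      member∈U (inj₂ (_ , p)) = proj₁ (petal-class p)

      -- A neighbour of `x` in the forest has the same ancestor on level `a`, hence the same root.
      -- If it is a petal vertex, then it also shares the class on level `β`, hence the piece.
      petal-closed : ∀ {s c x y} → Petal s c x → Adj G x y → Member y → y ∈ˡ s ∷ piece s c
      petal-closed {x = x} {y} p@(r , c∈ , _) xy m@(inj₁ y-root@(_ , y≡a , _)) =
        let x∈U , β≤x , _ = petal-class p
            y~x = adjacent-cls (member∈U m) x∈U (symm G xy) (≤-reflexive (sym y≡a))
                    (≤-trans (<⇒≤ a<β) β≤x)
        in here (sym (root-unique r y-root (trans (below-root r c∈ (petal-class p)) (sym y~x))))
      petal-closed {s} {c} {x} {y} p@(r , c∈ , _) xy m@(inj₂ (t , q@(r′ , c′∈ , y∈)))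
        with petal-class p | petal-class q
      ... | x∈U , β≤x , refl | y∈U , β≤y , _
        with adjacent-cls x∈U y∈U xy β≤x β≤y
      ... | x~y with root-unique r r′ (trans (below-root r c∈ (petal-class p))
                       (trans (coarsen-≤ (<⇒≤ a<β) x~y) (sym (below-root r′ c′∈ (petal-class q)))))
      ... | refl = there (subst (λ c → y ∈ˡ piece s c) (sym x~y) y∈)

      petal-no-core : {Z : Fin n → Set} → (∀ {x} → Z x → x ∈ F) → Core G Z →
                      ∀ {s c x} → Petal s c x → ¬ Z x
      petal-no-core Z⊆F core {s} {c} (r , c∈ , x∈) = pathTo-no-core (proj₁ (proj₂ (proj₂ (piece-ok r c∈))))
        (λ y∈ zy → let p , q , p≢q , (yp , zp) , (yq , zq) = core zy
                       closed = λ {w} yw zw → petal-closed {y = w} (r , c∈ , y∈) yw (∈-⟪⟫⁻ member? (Z⊆F zw))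
                   in p , q , p≢q , (yp , zp , closed yp zp) , (yq , zq , closed yq zq))
        x∈

      -- Petals are excluded first. What remains of a core consists of roots, and vertices on one
      -- level are not adjacent.
      no-core : {Z : Fin n → Set} → (∀ {x} → Z x → x ∈ F) → Core G Z → ∀ {x} → ¬ Z x
      no-core Z⊆F core zx with ∈-⟪⟫⁻ member? (Z⊆F zx)
      ... | inj₂ (_ , p) = petal-no-core Z⊆F core p zx
      ... | inj₁ (x∈ , x≡a , _) with core zx
      ...   | y , _ , _ , (xy , zy) , _ with ∈-⟪⟫⁻ member? (Z⊆F zy)
      ...     | inj₁ (y∈ , y≡a , _) = adjacent-level≢ x∈ y∈ xy (trans x≡a (sym y≡a))
      ...     | inj₂ (_ , p) = petal-no-core Z⊆F core p zy

      first : ∀ {s c} → Root s → c ∈ˡ relevant β s → ∃ λ y → Petal s c y × Adj G s y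
      first r c∈ = let _ , _ , π , _ = piece-ok r c∈
                       y , y∈ , sy = pathTo-next π
                   in y , (r , c∈ , y∈) , sy

      -- The first vertices of petals in distinct classes are distinct and not adjacent, so together
      -- with `s` they form an induced star. The class of each leaf is recorded to separate it from
      -- the next one.
      star : ∀ {s} → Root s → ∀ c cs → Unique (c ∷ cs) → All (_∈ˡ relevant β s) (c ∷ cs) →
             ∃₂ λ v xs → Grown G s v xs × length xs ≡ suc (length (c ∷ cs)) ×
                         All (λ x → x ∈ F × (x ≡ s ⊎ ∃ λ e → e ∈ˡ c ∷ cs × InClass β e x)) xs
      star {s} r c [] _ (c∈ ∷ []) =
        let y , p , sy = first r c∈
        in y , y ∷ s ∷ [] , base sy , refl ,
           (petal∈F p , inj₂ (c , here refl , petal-class p)) ∷ (root∈F r , inj₁ refl) ∷ []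
      star {s} r c (c′ ∷ cs) (c≢ ∷ u) (c∈ ∷ cs∈) with first r c∈ | star r c′ cs u cs∈
      ... | y , p , sy | v , xs , t , len , h =
        v , y ∷ xs , grow y∉ (lose (grown-u t) (symm G sy , All.map only h)) t , cong suc len ,
        (petal∈F p , inj₂ (c , here refl , petal-class p)) ∷ All.map widen h
        where
        widen : ∀ {x} → x ∈ F × (x ≡ s ⊎ ∃ λ e → e ∈ˡ c′ ∷ cs × InClass β e x) →
                x ∈ F × (x ≡ s ⊎ ∃ λ e → e ∈ˡ c ∷ c′ ∷ cs × InClass β e x)
        widen (x∈F , inj₁ eq) = x∈F , inj₁ eq
        widen (x∈F , inj₂ (e , e∈ , i)) = x∈F , inj₂ (e , there e∈ , i)

        only : ∀ {q} → q ∈ F × (q ≡ s ⊎ ∃ λ e → e ∈ˡ c′ ∷ cs × InClass β e q) → Adj G y q → q ≡ s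
        only (_ , inj₁ eq) _ = eq
        only (_ , inj₂ (e , e∈ , q∈U , β≤q , q≡)) yq =
          let y∈U , β≤y , y≡ = petal-class p
          in contradiction (trans (sym y≡) (trans (adjacent-cls y∈U q∈U yq β≤y β≤q) q≡))
                           (All.lookup c≢ e∈)

        y∉ : y ∉ˡ xs
        y∉ y∈ with All.lookup h y∈
        ... | _ , inj₁ refl = irrefl G refl sy
        ... | _ , inj₂ (e , e∈ , _ , _ , y≡e) =
          All.lookup c≢ e∈ (trans (sym (proj₂ (proj₂ (petal-class p)))) y≡e)

      root-tree : ∀ {s} → Root s → ∃₂ λ v xs → Grown G s v xs × suc (suc k) ≤ length xs × All (_∈ F) xs
      root-tree {s} r@(_ , _ , heavy) = grown-star (relevant β s) (relevant-! β s) (All.tabulate id) heavy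
        where
        grown-star : ∀ cs → Unique cs → All (_∈ˡ relevant β s) cs → suc k ≤ length cs →
                     ∃₂ λ v xs → Grown G s v xs × suc (suc k) ≤ length xs × All (_∈ F) xs
        grown-star (c ∷ cs) u cs∈ le =
          let v , xs , t , len , h = star r c cs u cs∈
          in v , xs , t , ≤-trans (s≤s le) (≤-reflexive (sym len)) , All.map proj₁ h

      bouquet-strong : IsStrongForest (suc k) G F
      bouquet-strong = strong-forest G F no-core λ x∈ → tree (∈-⟪⟫⁻ member? x∈)
        where
        tree : ∀ {x} → Member x → ∃₂ λ u v → ∃[ xs ] Grown G u v xs × suc (suc k) ≤ length xs ×
               All (_∈ F) xs × Walk (G [ F ]) x u
        tree {x} (inj₁ r) = let v , xs , t , len , in-F = root-tree r in x , v , xs , t , len , in-F , ε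
        tree {x} (inj₂ (s , r , c∈ , x∈)) =
          let v , xs , t , len , in-F = root-tree r
              _ , _ , π , _ = piece-ok r c∈
          in s , v , xs , t , len , in-F ,
             linked-walk G F (pathTo-linked π)
               (root∈F r ∷ All.tabulate (λ y∈ → petal∈F (r , c∈ , y∈))) (there x∈)

  grown-cls : ∀ {u v i xs} → Grown G u v xs → All (λ y → y ∈ U × i ≤ level y) xs →
              ∀ {x} → x ∈ˡ xs → cls i x ≡ cls i u
  grown-cls (base uv) ((v∈ , i≤v) ∷ (u∈ , i≤u) ∷ []) (here refl) = sym (adjacent-cls u∈ v∈ uv i≤u i≤v)
  grown-cls (base uv) _ (there (here refl)) = refl
  grown-cls (grow _ att t) ((z∈ , i≤z) ∷ h) (here refl) =
    let p , p∈ , zp , _ = find att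
        p∈U , i≤p = All.lookup h p∈
    in trans (adjacent-cls z∈ p∈U zp i≤z i≤p) (grown-cls t h p∈)
  grown-cls (grow _ _ t) (_ ∷ h) (there x∈) = grown-cls t h x∈

  module Grove (a : ℕ) (tree : Fin n → List (Fin n)) where

    Member : Fin n → Set
    Member x = ∃ λ t → (t ∈ U × level t ≡ a) × x ∈ˡ tree t

    member? : Decidable Member
    member? x = any? λ t → (t ∈? U ×-dec level t ℕ.≟ a) ×-dec Any.any? (x ≟_) (tree t)

    F : Subset n
    F = ⟪ member? ⟫

    -- The list is empty for a `t` without a suitable tree, so the condition speaks of nonempty
    -- lists only.
    module _ (tree-ok : ∀ {t x} → x ∈ˡ tree t → ∃₂ λ u v → Grown G u v (tree t) ×
                suc (suc k) ≤ length (tree t) × All (λ y → y ∈ U × level t ≤ level y) (tree t) ×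
                t ∈ˡ tree t) where

      tree-facts : ∀ {t x} → level t ≡ a → x ∈ˡ tree t → x ∈ U × a ≤ level x × cls a x ≡ cls a t
      tree-facts refl x∈ with tree-ok x∈
      ... | _ , _ , t , _ , h , t∈ =
        let x∈U , a≤x = All.lookup h x∈
        in x∈U , a≤x , trans (grown-cls t h x∈) (sym (grown-cls t h t∈))

      -- All of a tree shares the class of its top on level `a`. An edge between two trees would
      -- identify these classes and hence the tops.
      tree-closed : ∀ {t x y} → t ∈ U × level t ≡ a → x ∈ˡ tree t → Adj G x y → Member y → y ∈ˡ tree t
      tree-closed (t∈ , refl) x∈ xy (t′ , (t′∈ , t′≡a) , y∈) with tree-facts refl x∈ | tree-facts t′≡a y∈
      ... | x∈U , a≤x , x~t | y∈U , a≤y , y~t′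
        with unique t∈ t′∈ (sym t′≡a) (trans (sym x~t) (trans (adjacent-cls x∈U y∈U xy a≤x a≤y) y~t′))
      ...   | refl = y∈

      grove-strong : IsStrongForest (suc k) G F
      grove-strong = strong-forest G F no-core big
        where
        no-core : {Z : Fin n → Set} → (∀ {x} → Z x → x ∈ F) → Core G Z → ∀ {x} → ¬ Z x
        no-core {Z} Z⊆F core zx with ∈-⟪⟫⁻ member? (Z⊆F zx)
        ... | t , top , x∈ = grown-no-core G (proj₁ (proj₂ (proj₂ (tree-ok x∈))))
          (λ y∈ zy → let p , q , p≢q , (yp , zp) , (yq , zq) = core zy
                         closed = λ {w} yw zw → tree-closed {y = w} top y∈ yw (∈-⟪⟫⁻ member? (Z⊆F zw))
                     in p , q , p≢q , (yp , zp , closed yp zp) , (yq , zq , closed yq zq))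
          x∈ zx

        big : ∀ {x} → x ∈ F → ∃₂ λ u v → ∃[ xs ] Grown G u v xs × suc (suc k) ≤ length xs ×
              All (_∈ F) xs × Walk (G [ F ]) x u
        big x∈F with ∈-⟪⟫⁻ member? x∈F
        ... | t , top , x∈ with tree-ok x∈
        ...   | u , v , tr , len , _ = u , v , tree t , tr , len , in-F , grown-walk G F tr in-F x∈
          where
          in-F : All (_∈ F) (tree t)
          in-F = All.tabulate λ y∈ → ∈-⟪⟫⁺ member? (t , top , y∈)

-- Covers and the number of forests

-- `E` may be any relation, since `covers` only asks for both ends to lie in `F`; adjacency in `G`
-- is supplied in `f≤`.
record Cov (k : ℕ) (G : Graph n) (E : Fin n → Fin n → Set) (N : ℕ) : Set where
  constructor cov
  field
    forests : List (Subset n)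
    count   : length forests ≤ N
    strong  : All (IsStrongForest k G) forests
    covers  : ∀ {u v} → E u v → Any (λ F → u ∈ F × v ∈ F) forests

cov-none : ∀ {k} {G : Graph n} {E N} → (∀ {u v} → ¬ E u v) → Cov k G E N
cov-none none = cov [] z≤n [] (λ e → contradiction e none)

cov-one : ∀ {k} {G : Graph n} {E} (F : Subset n) → IsStrongForest k G F →
          (∀ {u v} → E u v → u ∈ F × v ∈ F) → Cov k G E 1
cov-one F strong covers = cov (F ∷ []) ≤-refl (strong ∷ []) (here ∘ covers)

cov-⊆ : ∀ {k} {G : Graph n} {E E′ M N} → (∀ {u v} → E′ u v → E u v) → M ≤ N →
        Cov k G E M → Cov k G E′ N
cov-⊆ sub M≤N (cov Fs len strong covers) = cov Fs (≤-trans len M≤N) strong (covers ∘ sub)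

cov-∪ : ∀ {k} {G : Graph n} {E E′ M N} → Cov k G E M → Cov k G E′ N →
        Cov k G (λ u v → E u v ⊎ E′ u v) (M + N)
cov-∪ (cov Fs len strong covers) (cov Fs′ len′ strong′ covers′) = cov (Fs ++ Fs′)
  (≤-trans (≤-reflexive (length-++ Fs)) (+-mono-≤ len len′))
  (All.++⁺ strong strong′)
  λ { (inj₁ e) → Any.++⁺ˡ (covers e) ; (inj₂ e) → Any.++⁺ʳ Fs (covers′ e) }

Σ< : ℕ → (ℕ → ℕ) → ℕ
Σ< zero    f = 0
Σ< (suc m) f = Σ< m f + f m

cov-Σ : ∀ {k} {G : Graph n} {E : ℕ → Fin n → Fin n → Set} {N : ℕ → ℕ} m →
        (∀ i → i < m → Cov k G (E i) (N i)) →
        Cov k G (λ u v → ∃ λ i → i < m × E i u v) (Σ< m N)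
cov-Σ zero    c = cov-none λ { (_ , () , _) }
cov-Σ {E = E} (suc m) c = cov-⊆ split ≤-refl (cov-∪ (cov-Σ m λ i i<m → c i (≤-trans i<m (n≤1+n m))) (c m ≤-refl))
  where
  split : ∀ {u v} → (∃ λ i → i < suc m × E i u v) → (∃ λ i → i < m × E i u v) ⊎ E m u v
  split (i , s≤s i≤m , e) with m≤n⇒m<n∨m≡n i≤m
  ... | inj₁ i<m  = inj₁ (i , i<m , e)
  ... | inj₂ refl = inj₂ e

Σ<-const : ∀ m c → Σ< m (λ _ → c) ≡ m * c
Σ<-const zero    c = refl
Σ<-const (suc m) c = trans (cong (_+ c) (Σ<-const m c)) (ℕ.+-comm (m * c) c)

cov-indexed : ∀ {k} {G : Graph n} {E : ℕ → Fin n → Fin n → Set} m →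
        (∀ j → Cov k G (E j) 1) → Cov k G (λ u v → ∃ λ j → j < m × E j u v) m
cov-indexed m c = cov-⊆ id (≤-reflexive (trans (Σ<-const m 1) (ℕ.*-identityʳ m)))
                        (cov-Σ m λ j _ → c j)

-- The first sum is for heavy pairs: `β` possible levels of `s`, times the positions in a list of
-- edges. The second is for edges without a heavy pair, by the level `a` of the top and a position.
total : ℕ → ℕ → ℕ
total k d = Σ< d (λ β → β * g k (d ∸ β)) + Σ< d (λ a → k * g k (d ∸ suc a))

-- Enumerating and covering the edges of a layered graph

module Counting (G : Graph n) (U : Subset n) (d : ℕ) (L : Layering G U d) (k : ℕ) where
  open Layering L
  open Pieces G U d L
  open Strong G U d L k

  node? : ∀ β c → Dec (∃ λ x → InClass β c x × level x ≡ β)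
  node? β c = any? λ x → inClass? β c x ×-dec level x ℕ.≟ β

  -- The edges that descend can reach from s and the class c on level β, when
  -- it meets no further heavy vertex; h is the number of levels left.
  mutual
    gen : ℕ → ℕ → Fin n → Label → List (Fin n × Fin n)
    gen zero β s c = []
    gen (suc h) β s c with node? β c
    ... | yes (x , _) = (s , x) ∷ children h (suc β) s ++ children h (suc β) x
    ... | no _        = children h (suc β) s

    children : ℕ → ℕ → Fin n → List (Fin n × Fin n)
    children h β s with heavy? β s
    ... | yes _ = []
    ... | no _  = concatMap (gen h β s) (relevant β s)

  mutual
    length-gen : ∀ h β s c → length (gen h β s c) ≤ g k h
    length-gen zero β s c = z≤n
    length-gen (suc h) β s c with node? β c
    ... | yes (x , _) = s≤s (≤-trans (≤-reflexive (length-++ (children h (suc β) s)))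
                              (+-mono-≤ (length-children h (suc β) s) (length-children h (suc β) x)))
    ... | no _ = ≤-trans (length-children h (suc β) s) (≤-trans (m≤m+n _ _) (n≤1+n _))

    length-children : ∀ h β s → length (children h β s) ≤ k * g k h
    length-children h β s with heavy? β s
    ... | yes _ = z≤n
    ... | no light = ≤-trans (length-concatMap≤ (gen h β s) (length-gen h β s) (relevant β s))
                             (*-monoˡ-≤ (g k h) (≤-pred (≰⇒> light)))

  -- `listed` places the edge among the at most `g k (d ∸ β)` ones that are reached from `s` and its
  -- class without a further heavy pair.
  record HeavyEdge (u v : Fin n) : Set where
    field
      {s}     : Fin n
      {β}     : ℕ
      s∈U     : s ∈ U
      s<β     : level s < β
      β≤v     : β ≤ level v
      heavy   : Heavy β s
      reach   : Reach s β (cls β v) u v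
      listed  : (u , v) ∈ˡ gen (d ∸ β) β s (cls β v)

  module _ {u v : Fin n} (v∈ : v ∈ U) (u<v : level u < level v) where

    -- A heavy pair is the one sought, as `uv` is already listed for it. Otherwise the class of `v`
    -- is among those that `children` runs through.
    into-children : ∀ {h β s} → d ∸ β ≡ h → s ∈ U → level s < β → β ≤ level v →
                    Reach s β (cls β v) u v → (u , v) ∈ˡ gen h β s (cls β v) →
                    (u , v) ∈ˡ children h β s ⊎ HeavyEdge u v
    into-children {β = β} {s} refl s∈ s<β β≤v r e∈ with heavy? β s
    ... | yes heavy = inj₂ (record { s∈U = s∈ ; s<β = s<β ; β≤v = β≤v ; heavy = heavy ; reach = r ; listed = e∈ })
    ... | no light  = inj₁ (∈-concatMap⁺ _ (lose (reach-relevant r) e∈))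

    -- Induction along `descend`. The recursive call comes before the test for heaviness, so the
    -- last heavy pair is the one reported.
    listed-or-heavy : ∀ h {β s} → d ∸ β ≡ h → s ∈ U → level s < β → β ≤ level v →
                      Reach s β (cls β v) u v →
                      (u , v) ∈ˡ gen h β s (cls β v) ⊎ HeavyEdge u v
    listed-or-heavy zero {β} eq _ _ β≤v _ with trans (sym eq) (∸-unfold (≤-<-trans β≤v (level< v∈)))
    ... | ()
    listed-or-heavy (suc h) {β} {s} eq s∈ s<β β≤v r@(xs , π , in-c) with m≤n⇒m<n∨m≡n β≤v
    -- On its own level `v` is the only vertex of its class; `u` lies higher and can only be `s`.
    ... | inj₂ β≡v = inj₁ here-listed
      where
      u≡s : u ≡ s
      u≡s with pathTo-u π
      ... | here u≡s = u≡s
      ... | there u∈ = contradiction (≤-trans (s≤s (proj₁ (proj₂ (All.lookup in-c u∈))))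
                                              (≤-trans u<v (≤-reflexive (sym β≡v)))) (<-irrefl refl)

      here-listed : (u , v) ∈ˡ gen (suc h) β s (cls β v)
      here-listed with node? β (cls β v)
      ... | no none = contradiction (v , (v∈ , β≤v , refl) , sym β≡v) none
      ... | yes (x , (x∈ , _ , x≡) , x≡β) = here (cong₂ _,_ u≡s (unique v∈ x∈ (trans (sym β≡v) (sym x≡β))
                (subst (λ i → cls i v ≡ cls i x) β≡v (sym x≡))))
    ... | inj₁ β<v with descend s∈ s<β v∈ β<v r
    ...   | s′ , choice , r′ with below choice
      where
      below : (s′ ≡ s ⊎ (InClass β (cls β v) s′ × level s′ ≡ β)) → s′ ∈ U × level s′ < suc β
      below (inj₁ refl) = s∈ , ≤-trans s<β (n≤1+n _)
      below (inj₂ ((s′∈ , _) , refl)) = s′∈ , ≤-refl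
    ...   | s′∈ , s′<β with suc-injective (trans (sym (∸-unfold (≤-<-trans β≤v (level< v∈)))) eq)
    ...   | eq′ with listed-or-heavy h eq′ s′∈ s′<β β<v r′
    ...     | inj₂ good = inj₂ good
    ...     | inj₁ e∈ with into-children eq′ s′∈ s′<β β<v r′ e∈
    ...       | inj₂ good = inj₂ good
    ...       | inj₁ e∈′  = inj₁ (place choice e∈′)
      where
      place : (s′ ≡ s ⊎ (InClass β (cls β v) s′ × level s′ ≡ β)) → (u , v) ∈ˡ children h (suc β) s′ →
              (u , v) ∈ˡ gen (suc h) β s (cls β v)
      place (inj₁ refl) e∈ with node? β (cls β v)
      ... | yes _ = there (∈-++⁺ˡ e∈)
      ... | no _  = e∈
      place (inj₂ ((s′∈ , β≤s′ , s′≡) , s′≡β)) e∈ with node? β (cls β v)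
      ... | no none = contradiction (s′ , (s′∈ , β≤s′ , s′≡) , s′≡β) none
      ... | yes (x , (x∈ , _ , x≡) , x≡β) with unique s′∈ x∈ (trans s′≡β (sym x≡β))
                (subst (λ i → cls i s′ ≡ cls i x) (sym s′≡β) (trans s′≡ (sym x≡)))
      ...   | refl = there (∈-++⁺ʳ (children h (suc β) s) e∈)

  TopTree : Fin n → Fin n → Fin n → List (Fin n) → Set
  TopTree t u v xs = Grown G u v xs × suc (suc k) ≤ length xs ×
                     All (λ y → y ∈ U × level t ≤ level y) xs × t ∈ˡ xs

  record LightEdge (u v : Fin n) : Set where
    field
      {t}    : Fin n
      {xs}   : List (Fin n)
      t∈U    : t ∈ U
      tree   : TopTree t u v xs
      listed : (u , v) ∈ˡ children (d ∸ suc (level t)) (suc (level t)) t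

  -- All tree vertices share their class on the level of the top `t`, so `t` is alone on that level,
  -- and the path from `t` continues in a single class one level down.
  classify : ∀ {u v xs} → level u < level v → Grown G u v xs → suc (suc k) ≤ length xs →
             All (_∈ U) xs → HeavyEdge u v ⊎ LightEdge u v
  classify {u} {v} {x ∷ xs} u<v tr len xs⊆U with lowest level x xs
  ... | t , t∈ , le with grown-path G tr t∈
  ...   | ys , π , _ ∷ ys⊆ = result
    where
    t∈U = All.lookup xs⊆U t∈
    v∈U = All.lookup xs⊆U (grown-v tr)

    t<v : level t < level v
    t<v = ≤-trans (s≤s (All.lookup le (grown-u tr))) u<v

    v∈ys : v ∈ˡ ys
    v∈ys with pathTo-v π
    ... | here refl = contradiction t<v (<-irrefl refl)
    ... | there v∈  = v∈

    lower : ∀ {z} → z ∈ˡ ys → z ∈ U × suc (level t) ≤ level z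
    lower z∈ with All.lookup ys⊆ z∈
    ... | z∈xs = All.lookup xs⊆U z∈xs , ≤∧≢⇒< (All.lookup le z∈xs) λ eq →
      All.lookup (AllPairs.head (pathTo-! π)) z∈ (unique t∈U (All.lookup xs⊆U z∈xs) eq
        (trans (grown-cls tr bounded t∈) (sym (grown-cls tr bounded z∈xs))))
      where
      bounded = All.zipWith id (xs⊆U , le)

    r : Reach t (suc (level t)) (cls (suc (level t)) v) u v
    r = ys , π , linked-inClass (Linked.tail (pathTo-linked π)) (All.tabulate lower) v∈ys

    result : HeavyEdge u v ⊎ LightEdge u v
    result with listed-or-heavy v∈U u<v _ refl t∈U ≤-refl t<v r
    ... | inj₂ good = inj₁ good
    ... | inj₁ e∈ with into-children v∈U u<v refl t∈U ≤-refl t<v r e∈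
    ...   | inj₂ good = inj₁ good
    ...   | inj₁ e∈′  = inj₂ (record { t∈U = t∈U ; tree = tr , len , All.zipWith id (xs⊆U , le) , t∈ ; listed = e∈′ })

  -- With the position `j` fixed, `s` and the class determine the edge, so one piece per class
  -- suffices.
  HeavyAt : (a β j : ℕ) → Fin n → Fin n → Set
  HeavyAt a β j u v = ∃ λ s → (s ∈ U × level s ≡ a × Heavy β s) × β ≤ level v ×
    Reach s β (cls β v) u v × head (drop j (gen (d ∸ β) β s (cls β v))) ≡ just (u , v)

  cov-heavyAt : ∀ {a β} → a < β → ∀ j → Cov (suc k) G (HeavyAt a β j) 1
  cov-heavyAt {a} {β} a<β j = cov-one F (bouquet-strong pick-ok) covers
    where
    edge? : ∀ s c → Dec (∃₂ λ u v → head (drop j (gen (d ∸ β) β s c)) ≡ just (u , v) × Reach s β c u v)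
    edge? s c = any? λ u → any? λ v →
      Maybe.≡-dec (Product.≡-dec _≟_ _≟_) (head (drop j (gen (d ∸ β) β s c))) (just (u , v)) ×-dec reach? s β c u v

    neighbour? : ∀ s c → Dec (∃ λ y → InClass β c y × Adj G s y)
    neighbour? s c = any? λ y → inClass? β c y ×-dec adj? G s y

    -- Without a `j`-th edge to reach, a single neighbour of `s` fills the class, so that `s` keeps
    -- a petal in every relevant class and its star stays large enough.
    pick : Fin n → Label → List (Fin n)
    pick s c with edge? s c | neighbour? s c
    ... | yes (_ , _ , _ , xs , _) | _           = xs
    ... | no _                     | yes (y , _) = y ∷ []
    ... | no _                     | no _        = []

    open Bouquet a β a<β pick

    pick-ok : ∀ {s c} → Root s → c ∈ˡ relevant β s →
              ∃₂ λ u v → PathTo G u v (s ∷ pick s c) × All (InClass β c) (pick s c)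
    pick-ok {s} {c} r c∈ with edge? s c | neighbour? s c
    ... | yes (u , v , _ , _ , π , in-c) | _ = u , v , π , in-c
    ... | no _ | yes (y , y∈ , sy)           = s , y , forth sy , y∈ ∷ []
    ... | no _ | no none                     = contradiction (∈-relevant⁻ c∈) none

    -- The search may find another path, but the position forces the same final edge.
    picked : ∀ {s c u v} → head (drop j (gen (d ∸ β) β s c)) ≡ just (u , v) → Reach s β c u v →
             PathTo G u v (s ∷ pick s c)
    picked {s} {c} eq r with edge? s c | neighbour? s c
    ... | no none | _ = contradiction (_ , _ , eq , r) none
    ... | yes (_ , _ , eq′ , _ , π , _) | _ with just-injective (trans (sym eq) eq′)
    ...   | refl = π

    covers : ∀ {u v} → HeavyAt a β j u v → u ∈ F × v ∈ F
    covers {v = v} (s , r , _ , reach , eq) = on-path (pathTo-u π) , on-path (pathTo-v π)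
      where
      π = picked eq reach

      on-path : ∀ {x} → x ∈ˡ s ∷ pick s (cls β v) → x ∈ F
      on-path (here refl) = root∈F r
      on-path (there x∈)  = petal∈F pick-ok (r , reach-relevant reach , x∈)

  cov-heavy : Cov (suc k) G HeavyEdge (Σ< d (λ β → β * g k (d ∸ β)))
  cov-heavy = cov-⊆ place ≤-refl (cov-Σ d λ β _ → cov-⊆ id (≤-reflexive (Σ<-const β _))
    (cov-Σ {E = λ a u v → ∃ λ j → j < g k (d ∸ β) × HeavyAt a β j u v} β λ a a<β →
      cov-indexed (g k (d ∸ β)) (cov-heavyAt a<β)))
    where
    place : ∀ {u v} → HeavyEdge u v → ∃ λ β → β < d × ∃ λ a → a < β × ∃ λ j → j < g k (d ∸ β) × HeavyAt a β j u v
    place e = let open HeavyEdge e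
                  j , j< , eq = ∈⇒drop listed
                  _ , (y∈ , β≤y , _) , _ = ∈-relevant⁻ (reach-relevant reach)
                  β<d = ≤-<-trans β≤y (level< y∈) in
      β , β<d , level s , s<β , j , ≤-trans j< (length-gen (d ∸ β) β s _) , s , (s∈U , refl , heavy) , β≤v , reach , eq

  LightAt : (a j : ℕ) → Fin n → Fin n → Set
  LightAt a j u v = ∃ λ t → (t ∈ U × level t ≡ a) × ∃ (TopTree t u v) ×
    head (drop j (children (d ∸ suc a) (suc a) t)) ≡ just (u , v)

  cov-lightAt : ∀ a j → Cov (suc k) G (LightAt a j) 1
  cov-lightAt a j = cov-one F (grove-strong pick-ok) covers
    where
    -- Any tree for the `j`-th edge of `t` will do; the search makes the choice depend on `t` alone.
    edge? : ∀ t → Dec (∃₂ λ u v → head (drop j (children (d ∸ suc a) (suc a) t)) ≡ just (u , v) × ∃ (TopTree t u v))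
    edge? t = any? λ u → any? λ v →
      Maybe.≡-dec (Product.≡-dec _≟_ _≟_) (head (drop j (children (d ∸ suc a) (suc a) t))) (just (u , v)) ×-dec
      anyUnique? (λ xs → grown? G u v xs ×-dec suc (suc k) ≤? length xs ×-dec
                         All.all? (λ y → y ∈? U ×-dec level t ≤? level y) xs ×-dec Any.any? (t ≟_) xs)
                 (grown-! ∘ proj₁)

    pick : Fin n → List (Fin n)
    pick t with edge? t
    ... | yes (_ , _ , _ , xs , _) = xs
    ... | no _                     = []

    open Grove a pick

    pick-ok : ∀ {t x} → x ∈ˡ pick t → ∃₂ λ u v → TopTree t u v (pick t)
    pick-ok {t} x∈ with edge? t
    ... | yes (u , v , _ , xs , tr) = u , v , tr

    picked : ∀ {t u v} → head (drop j (children (d ∸ suc a) (suc a) t)) ≡ just (u , v) → ∃ (TopTree t u v) →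
             Grown G u v (pick t)
    picked {t} eq tr with edge? t
    ... | no none = contradiction (_ , _ , eq , tr) none
    ... | yes (_ , _ , eq′ , _ , tr′ , _) with just-injective (trans (sym eq) eq′)
    ...   | refl = tr′

    covers : ∀ {u v} → LightAt a j u v → u ∈ F × v ∈ F
    covers (t , top , tr , eq) =
      ∈-⟪⟫⁺ member? (t , top , grown-u (picked eq tr)) , ∈-⟪⟫⁺ member? (t , top , grown-v (picked eq tr))

  cov-light : Cov (suc k) G LightEdge (Σ< d (λ a → k * g k (d ∸ suc a)))
  cov-light = cov-⊆ place ≤-refl (cov-Σ d λ a _ → cov-indexed (k * g k (d ∸ suc a)) (cov-lightAt a))
    where
    place : ∀ {u v} → LightEdge u v → ∃ λ a → a < d × ∃ λ j → j < k * g k (d ∸ suc a) × LightAt a j u v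
    place e = let open LightEdge e
                  j , j< , eq = ∈⇒drop listed in
      level t , level< t∈U , j , ≤-trans j< (length-children _ _ t) , t , (t∈U , refl) , (_ , tree) , eq

  cov-layered : Cov (suc k) G (λ u v → level u < level v × ∃ λ xs → Grown G u v xs ×
                  suc (suc k) ≤ length xs × All (_∈ U) xs) (total k d)
  cov-layered = cov-⊆ (λ (u<v , _ , tr , len , xs⊆U) → classify u<v tr len xs⊆U) ≤-refl (cov-∪ cov-heavy cov-light)

-- From tree-depth to layerings

-- If the second vertices differed, then the rests of the two paths would join them through `r`
-- while avoiding `x`, a detour that closes a cycle.
acyclic⇒path-unique : (G : Graph n) → Acyclic G → ∀ {x r xs ys} →
                      IsPath G x r xs → IsPath G x r ys → xs ≡ ys
acyclic⇒path-unique G acyc {xs = x ∷ []} {x ∷ []} (isPath refl _ _ _ _) (isPath refl _ _ _ _) = refl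
acyclic⇒path-unique G acyc {xs = x ∷ []} {x ∷ y ∷ ys} (isPath refl refl _ _ _) (isPath refl e _ _ (x∉ ∷ _)) =
  contradiction (last-∈ (y ∷ ys) e) (All≢⇒∉ x∉)
acyclic⇒path-unique G acyc {xs = x ∷ y ∷ ys} {x ∷ []} (isPath refl e _ _ (x∉ ∷ _)) (isPath refl refl _ _ _) =
  contradiction (last-∈ (y ∷ ys) e) (All≢⇒∉ x∉)
acyclic⇒path-unique {n} G acyc {x} {r} {x ∷ y ∷ xs} {x ∷ z ∷ ys}
    p@(isPath refl e _ (xy ∷ l) (x∉ ∷ _)) q@(isPath refl e′ _ (xz ∷ l′) (x∉′ ∷ _)) =
  cong (x ∷_) (acyclic⇒path-unique G acyc (path-tail p)
    (subst (λ w → IsPath G w r (z ∷ ys)) (sym (decidable-stable (y ≟ z) ¬y≢z)) (path-tail q)))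
  where
  ≢x? : Decidable (x ≢_)
  ≢x? w = ¬? (x ≟ w)

  S = ⟪ ≢x? ⟫

  avoid : ∀ {zs} → All (x ≢_) zs → ∀ {w} → w ∈ˡ zs → w ∈ S
  avoid x≢ w∈ = ∈-⟪⟫⁺ ≢x? (All.lookup x≢ w∈)

  ¬y≢z : ¬ y ≢ z
  ¬y≢z y≢z = acyc (detour⇒cycle G S (λ x∈S → ∈-⟪⟫⁻ ≢x? x∈S refl) xy xz y≢z (avoid x∉ (here refl))
    (walk-sym (G [ S ]) (linked-walk G S l (All.tabulate (avoid x∉)) (last-∈ (y ∷ xs) e)) ◅◅
     linked-walk G S l′ (All.tabulate (avoid x∉′)) (last-∈ (z ∷ ys) e′)))

Prefix : List A → List A → Set _
Prefix xs ys = ∃ λ zs → ys ≡ xs ++ zs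

prefix-< : {xs ys : List A} → Prefix xs ys → xs ≢ ys → length xs < length ys
prefix-< {xs = xs} ([] , refl) xs≢ = contradiction (sym (++-identityʳ xs)) xs≢
prefix-< {xs = xs} (z ∷ zs , refl) _ =
  ≤-trans (≤-trans (s≤s (m≤m+n _ _)) (≤-reflexive (sym (ℕ.+-suc _ _)))) (≤-reflexive (sym (length-++ xs)))

take-length : {xs ys : List A} → Prefix xs ys → take (length xs) ys ≡ xs
take-length {xs = []}     _          = refl
take-length {xs = x ∷ xs} (zs , refl) = cong (x ∷_) (take-length (zs , refl))

take-coarsen : ∀ i (xs ys : List A) → take (suc i) xs ≡ take (suc i) ys → take i xs ≡ take i ys
take-coarsen zero    _        _        _  = refl
take-coarsen (suc i) []       []       _  = refl
take-coarsen (suc i) (x ∷ xs) (y ∷ ys) eq =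
  let x≡y , rest = ∷-injective eq in cong₂ _∷_ x≡y (take-coarsen i xs ys rest)

-- An address lists the ancestors of a vertex from the root. Lists of numbers give all components
-- one type of addresses, although their trees have different sizes.
record Addressing (H : Graph n) (d : ℕ) : Set where
  field
    address    : Fin n → List ℕ
    nonempty   : ∀ {v} → v ∈ V H → 1 ≤ length (address v)
    bounded    : ∀ {v} → v ∈ V H → length (address v) ≤ d
    injective  : ∀ {u v} → u ∈ V H → v ∈ V H → address u ≡ address v → u ≡ v
    comparable : ∀ {u v} → Adj H u v → Prefix (address u) (address v) ⊎ Prefix (address v) (address u)

module RootPaths {m} (T : RootedTree m) where
  open RootedTree T hiding (closure; HasDepth)

  up : Fin m → List (Fin m)
  up v with v ∈? V tree
  ... | yes v∈ = proj₁ (connected v root v∈ root∈V)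
  ... | no _   = []

  up-path : ∀ {v} → v ∈ V tree → IsPath tree v root (up v)
  up-path {v} v∈ with v ∈? V tree
  ... | yes v∈′ = proj₂ (connected v root v∈′ root∈V)
  ... | no v∉   = contradiction v∈ v∉

  up-∷ : ∀ {v} → v ∈ V tree → ∃ λ xs → up v ≡ v ∷ xs
  up-∷ {v} v∈ with up v | up-path v∈
  ... | _ ∷ xs | isPath refl _ _ _ _ = xs , refl

  onRootPath⇒suffix : ∀ {u v} → OnRootPath u v → ∃ λ pre → up u ≡ pre ++ up v
  onRootPath⇒suffix o@(xs , p , v∈xs) =
    let u∈ , v∈ = OnRootPath⇒∈V o
        pre , ys , eq , q = path-suffix p v∈xs
    in pre , trans (acyclic⇒path-unique tree acyclic (up-path u∈) p)
                   (trans eq (cong (pre ++_) (acyclic⇒path-unique tree acyclic q (up-path v∈))))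

  -- For a tree edge, either `v` lies on the root path of `u`, or that path extends to `v`.
  closure-comparable : ∀ {u v} → Adj (closure T) u v → OnRootPath u v ⊎ OnRootPath v u
  closure-comparable (inj₂ (_ , o)) = o
  closure-comparable {u} {v} (inj₁ uv) with Adj⇒∈V tree uv
  ... | u∈ , v∈ with Any.any? (v ≟_) (up u)
  ...   | yes v∈up = inj₁ (up u , up-path u∈ , v∈up)
  ...   | no  v∉up with up-∷ u∈
  ...     | _ , eq = inj₂ (v ∷ up u , path-∷ (symm tree uv) v∉up (up-path u∈) ,
                          there (subst (u ∈ˡ_) (sym eq) (here refl)))

  -- Reversal turns the root path of an ancestor into a prefix.
  down : Fin m → List ℕ
  down v = map toℕ (reverseˡ (up v))

  length-down : ∀ v → length (down v) ≡ length (up v)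
  length-down v = trans (length-map toℕ (reverseˡ (up v))) (length-reverse (up v))

  down-injective : ∀ {u v} → u ∈ V tree → v ∈ V tree → down u ≡ down v → u ≡ v
  down-injective u∈ v∈ eq =
    let _ , eu = up-∷ u∈
        _ , ev = up-∷ v∈
    in ∷-injectiveˡ (trans (sym eu) (trans (reverse-injective (map-injective toℕ-injective eq)) ev))

  onRootPath⇒prefix : ∀ {u v} → OnRootPath u v → Prefix (down v) (down u)
  onRootPath⇒prefix {u} {v} o with onRootPath⇒suffix o
  ... | pre , eq = map toℕ (reverseˡ pre) ,
    trans (cong (map toℕ ∘ reverseˡ) eq)
      (trans (cong (map toℕ) (reverse-++ pre (up v))) (map-++ toℕ (reverseˡ (up v)) (reverseˡ pre)))

subgraph-addressing : ∀ {m d} (H : Graph n) (T : RootedTree m) → HasDepth T d →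
                      IsSubgraphOf H (closure T) → Addressing H d
subgraph-addressing H T (_ , deepest) (φ , φ∈ , φ-inj , φ-adj) = record
  { address = down ∘ φ
  ; nonempty = λ {v} v∈ → ≤-trans (≤-trans (s≤s z≤n) (≤-reflexive (sym (cong length (proj₂ (up-∷ (φ∈ v∈)))))))
                            (≤-reflexive (sym (length-down (φ v))))
  ; bounded = λ {v} v∈ → ≤-trans (≤-reflexive (length-down (φ v)))
                           (deepest _ (φ v , up (φ v) , up-path (φ∈ v∈) , refl))
  ; injective = λ u∈ v∈ eq → φ-inj u∈ v∈ (down-injective (φ∈ u∈) (φ∈ v∈) eq)
  ; comparable = λ uv → comparable (closure-comparable (φ-adj uv))
  }
  where
  open RootPaths T
  open RootedTree T using (OnRootPath)

  comparable : ∀ {u v} → OnRootPath u v ⊎ OnRootPath v u → Prefix (down u) (down v) ⊎ Prefix (down v) (down u)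
  comparable (inj₁ o) = inj₂ (onRootPath⇒prefix o)
  comparable (inj₂ o) = inj₁ (onRootPath⇒prefix o)

comp-cong : (G : Graph n) → ∀ {u v} → Adj G u v → ⟪ joined? G u ⟫ ≡ ⟪ joined? G v ⟫
comp-cong G {u} {v} uv = tabulate-cong λ w → does-⇔ (mk⇔
  (λ (_ , p) → walk⇒path G v∈ (symm G uv ◅ path⇒walk p))
  (λ (_ , p) → walk⇒path G u∈ (uv ◅ path⇒walk p))) (joined? G u w) (joined? G v w)
  where
  u∈ = proj₁ (Adj⇒∈V G uv)
  v∈ = proj₂ (Adj⇒∈V G uv)

-- Irrelevance of the proof makes all vertices of K draw their addresses from
-- the same tree.
addressing⇒layering : (G : Graph n) → ∀ {d} → (∀ K → .(IsComponent G K) → Addressing (G [ K ]) d) →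
                      Layering G (V G) d
addressing⇒layering {n} G {d} addressing = record
  { Label = Subset n × List ℕ
  ; _≟ᴸ_ = Product.≡-dec (Vec.≡-dec Bool._≟_) (List.≡-dec ℕ._≟_)
  ; level = level
  ; cls = cls
  ; level< = λ x∈ → ≤-trans (≤-reflexive (suc-level x∈))
      (≤-trans (≤-reflexive (cong length (addr-≡ x∈ refl (component x∈))))
               (bounded (addressing _ (component x∈)) (own∈ x∈)))
  ; coarsen = λ {i} {x} {y} eq → let e , e′ = Product.,-injective eq in
      cong₂ _,_ e (take-coarsen (suc i) (addr x) (addr y) e′)
  ; unique = λ {x} {y} x∈ y∈ lx≡ly eq → let e , e′ = Product.,-injective eq in
      addr-injective x∈ y∈ e (trans (sym (take-addr x∈))
        (trans e′ (trans (cong (λ l → take (suc l) (addr y)) lx≡ly) (take-addr y∈))))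
  ; adjacent = λ x∈ y∈ xy → adjacent x∈ y∈ xy
  }
  where
  open Addressing

  comp : Fin n → Subset n
  comp v = ⟪ joined? G v ⟫

  component : ∀ {v} → v ∈ V G → IsComponent G (comp v)
  component = joined-component G

  addr : Fin n → List ℕ
  addr v with v ∈? V G
  ... | yes v∈ = address (addressing (comp v) (component v∈)) v
  ... | no _   = []

  addr-≡ : ∀ {K v} → v ∈ V G → comp v ≡ K → .(c : IsComponent G K) → addr v ≡ address (addressing K c) v
  addr-≡ {v = v} v∈ refl c with v ∈? V G
  ... | yes _ = refl
  ... | no v∉ = contradiction v∈ v∉

  -- An address counts the vertex itself, while levels start at 0.
  level : Fin n → ℕ
  level v = length (addr v) ∸ 1

  -- Addresses in different components may coincide, so the component is part of the label. The
  -- first `suc i` entries name the ancestor on level `i`.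
  cls : ℕ → Fin n → Subset n × List ℕ
  cls i v = comp v , take (suc i) (addr v)

  ∈comp : ∀ {v} → v ∈ V G → v ∈ comp v
  ∈comp v∈ = ∈-⟪⟫⁺ (joined? G _) (walk⇒path G v∈ ε)

  own∈ : ∀ {v} → v ∈ V G → v ∈ V (G [ comp v ])
  own∈ v∈ = x∈p∩q⁺ (v∈ , ∈comp v∈)

  suc-level : ∀ {x} → x ∈ V G → suc (level x) ≡ length (addr x)
  suc-level {x} x∈ = ℕ.m+[n∸m]≡n (≤-trans (nonempty (addressing _ (component x∈)) (own∈ x∈))
    (≤-reflexive (cong length (sym (addr-≡ x∈ refl (component x∈))))))

  take-addr : ∀ {x} → x ∈ V G → take (suc (level x)) (addr x) ≡ addr x
  take-addr x∈ = take-all _ _ (≤-reflexive (sym (suc-level x∈)))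

  addr-injective : ∀ {x y} → x ∈ V G → y ∈ V G → comp x ≡ comp y → addr x ≡ addr y → x ≡ y
  addr-injective {x} {y} x∈ y∈ eq eq′ = injective (addressing (comp x) (component x∈)) (own∈ x∈)
    (x∈p∩q⁺ (y∈ , subst (y ∈_) (sym eq) (∈comp y∈)))
    (trans (sym (addr-≡ x∈ refl (component x∈))) (trans eq′ (addr-≡ y∈ (sym eq) (component x∈))))

  prefix-adjacent : ∀ {x y} → x ∈ V G → y ∈ V G → Adj G x y → Prefix (addr x) (addr y) →
                    level x < level y × cls (level x) x ≡ cls (level x) y
  prefix-adjacent {x} {y} x∈ y∈ xy p =
    ≤-pred (≤-trans (s≤s (≤-reflexive (suc-level x∈)))
      (≤-trans (prefix-< p λ eq → irrefl G (addr-injective x∈ y∈ (comp-cong G xy) eq) xy)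
               (≤-reflexive (sym (suc-level y∈))))) ,
    cong₂ _,_ (comp-cong G xy) (trans (take-addr x∈)
      (sym (trans (cong (λ l → take l (addr y)) (suc-level x∈)) (take-length p))))

  adjacent : ∀ {x y} → x ∈ V G → y ∈ V G → Adj G x y →
             (level x < level y × cls (level x) x ≡ cls (level x) y) ⊎
             (level y < level x × cls (level y) y ≡ cls (level y) x)
  adjacent {x} {y} x∈ y∈ xy
    with comparable (addressing (comp x) (component x∈))
           (xy , ∈comp x∈ , subst (y ∈_) (sym (comp-cong G xy)) (∈comp y∈))
       | addr-≡ x∈ refl (component x∈) | addr-≡ y∈ (comp-cong G (symm G xy)) (component x∈)
  ... | inj₁ p | ex | ey = inj₁ (prefix-adjacent x∈ y∈ xy (subst (Prefix _) (sym ey) (subst (λ z → Prefix z _) (sym ex) p)))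
  ... | inj₂ p | ex | ey = inj₂ (prefix-adjacent y∈ x∈ (symm G xy) (subst (Prefix _) (sym ex) (subst (λ z → Prefix z _) (sym ey) p)))

treeDepth⇒layering : (G : Graph n) → ∀ {d} → HasTreeDepth G d → Layering G (V G) d
treeDepth⇒layering G {d} (elim , _) = addressing⇒layering G addressing
  where
  addressing : ∀ K → .(IsComponent G K) → Addressing (G [ K ]) d
  addressing K c =
    let _ , T , depth , sub = elim K (recompute (isComponent? G K) c)
    in subgraph-addressing (G [ K ]) T depth sub

-- Selecting levels

Decreasing : List ℕ → Set
Decreasing = AllPairs _>_

-- For a decreasing list this is the number of its elements below `x`, which renumbers the selected
-- levels from 0.
rank : List ℕ → ℕ → ℕ
rank []      x = 0
rank (i ∷ I) x with i ℕ.<? x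
... | yes _ = suc (length I)
... | no _  = rank I x

-- The j-th smallest element of a decreasing list, and its largest element
-- when j is out of range, so that the function is monotone.
at : List ℕ → ℕ → ℕ
at []      j = 0
at (i ∷ I) j with j ℕ.<? length I
... | yes _ = at I j
... | no _  = i

rank-top : ∀ {x} I → All (x >_) I → rank I x ≡ length I
rank-top []      _ = refl
rank-top {x} (i ∷ I) (i<x ∷ _) with i ℕ.<? x
... | yes _  = refl
... | no i≮x = contradiction i<x i≮x

rank-here : ∀ {i} I → All (i >_) I → rank (i ∷ I) i ≡ length I
rank-here {i} I i> with i ℕ.<? i
... | yes i<i = contradiction i<i (<-irrefl refl)
... | no _    = rank-top I i>

rank-there : ∀ {i x} I → x < i → rank (i ∷ I) x ≡ rank I x
rank-there {i} {x} I x<i with i ℕ.<? x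
... | yes i<x = contradiction i<x (<-asym x<i)
... | no _    = refl

rank< : ∀ {I x} → Decreasing I → x ∈ˡ I → rank I x < length I
rank< {i ∷ I} (i> ∷ _) (here refl) = s≤s (≤-reflexive (rank-here I i>))
rank< {i ∷ I} (i> ∷ D) (there x∈)  =
  ≤-trans (s≤s (≤-reflexive (rank-there I (All.lookup i> x∈)))) (≤-trans (rank< D x∈) (n≤1+n _))

rank-mono : ∀ {I x y} → Decreasing I → x ∈ˡ I → x < y → rank I x < rank I y
rank-mono {i ∷ I} {x} {y} D@(_ ∷ D′) x∈ x<y with i ℕ.<? y
... | yes _  = rank< D x∈
rank-mono {i ∷ I} (i> ∷ D) (here refl) x<y | no i≮y = contradiction x<y i≮y
rank-mono {i ∷ I} (i> ∷ D) (there x∈)  x<y | no _   =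
  ≤-trans (s≤s (≤-reflexive (rank-there I (All.lookup i> x∈)))) (rank-mono D x∈ x<y)

at-rank : ∀ {I x} → Decreasing I → x ∈ˡ I → at I (rank I x) ≡ x
at-rank {i ∷ I} (i> ∷ D) (here refl) rewrite rank-here I i> with length I ℕ.<? length I
... | yes l<l = contradiction l<l (<-irrefl refl)
... | no _    = refl
at-rank {i ∷ I} {x} (i> ∷ D) (there x∈) rewrite rank-there I (All.lookup i> x∈) with rank I x ℕ.<? length I
... | yes _ = at-rank D x∈
... | no r≮ = contradiction (rank< D x∈) r≮

at-bounded : ∀ {i} I → All (i >_) I → ∀ j → at I j ≤ i
at-bounded []      _         j = z≤n
at-bounded (x ∷ I) (x<i ∷ i>) j with j ℕ.<? length I
... | yes _ = at-bounded I i> j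
... | no _  = <⇒≤ x<i

at-mono : ∀ {I} → Decreasing I → ∀ j → at I j ≤ at I (suc j)
at-mono {[]}    _        j = z≤n
at-mono {i ∷ I} (i> ∷ D) j with j ℕ.<? length I | suc j ℕ.<? length I
... | yes _  | yes _   = at-mono D j
... | yes _  | no _    = at-bounded I i> j
... | no j≮  | yes sj< = contradiction (≤-trans (n≤1+n _) sj<) j≮
... | no _   | no _    = ≤-refl

module Restrict {G : Graph n} {U : Subset n} {d : ℕ} (L : Layering G U d) where
  open Layering L

  onLevels? : ∀ I → Decidable (λ x → x ∈ U × level x ∈ˡ I)
  onLevels? I x = x ∈? U ×-dec Any.any? (level x ℕ.≟_) I

  onLevels : List ℕ → Subset n
  onLevels I = ⟪ onLevels? I ⟫

  -- The ancestors on the selected levels again form an elimination forest; `at` recovers the old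
  -- level from the new one.
  restrict : ∀ {I} → Decreasing I → Layering G (onLevels I) (length I)
  restrict {I} D = record
    { Label = Label
    ; _≟ᴸ_ = _≟ᴸ_
    ; level = λ x → rank I (level x)
    ; cls = λ j → cls (at I j)
    ; level< = λ x∈ → rank< D (level∈ x∈)
    ; coarsen = λ {j} → coarsen-≤ (at-mono D j)
    ; unique = λ {x} {y} x∈ y∈ eq same →
        let lx≡ly = trans (sym (at-rank D (level∈ x∈))) (trans (cong (at I) eq) (at-rank D (level∈ y∈)))
        in unique (∈U x∈) (∈U y∈) lx≡ly (subst (λ i → cls i x ≡ cls i y) (at-rank D (level∈ x∈)) same)
    ; adjacent = adjacent′
    }
    where
    ∈U : ∀ {x} → x ∈ onLevels I → x ∈ U
    ∈U x∈ = proj₁ (∈-⟪⟫⁻ (onLevels? I) x∈)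

    level∈ : ∀ {x} → x ∈ onLevels I → level x ∈ˡ I
    level∈ x∈ = proj₂ (∈-⟪⟫⁻ (onLevels? I) x∈)

    lift : ∀ {x y} → x ∈ onLevels I → level x < level y × cls (level x) x ≡ cls (level x) y →
           rank I (level x) < rank I (level y) ×
           cls (at I (rank I (level x))) x ≡ cls (at I (rank I (level x))) y
    lift {x} {y} x∈ (x<y , eq) = rank-mono D (level∈ x∈) x<y ,
      subst (λ i → cls i x ≡ cls i y) (sym (at-rank D (level∈ x∈))) eq

    adjacent′ : ∀ {x y} → x ∈ onLevels I → y ∈ onLevels I → Adj G x y →
      (rank I (level x) < rank I (level y) ×
        cls (at I (rank I (level x))) x ≡ cls (at I (rank I (level x))) y) ⊎
      (rank I (level y) < rank I (level x) ×
        cls (at I (rank I (level y))) y ≡ cls (at I (rank I (level y))) x)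
    adjacent′ x∈ y∈ xy with adjacent (∈U x∈) (∈U y∈) xy
    ... | inj₁ below = inj₁ (lift x∈ below)
    ... | inj₂ above = inj₂ (lift y∈ above)

-- The subsets of the numbers below `d` with `j` elements, as decreasing lists.
choose : ℕ → ℕ → List (List ℕ)
choose d       zero    = [] ∷ []
choose zero    (suc j) = []
choose (suc d) (suc j) = map (d ∷_) (choose d j) ++ choose d (suc j)

length-choose : ∀ d j → length (choose d j) ≡ d C j
length-choose d       zero    = refl
length-choose zero    (suc j) = sym (k>n⇒nCk≡0 {0} {suc j} (s≤s z≤n))
length-choose (suc d) (suc j) = trans (length-++ (map (d ∷_) (choose d j)))
  (trans (cong₂ _+_ (trans (length-map (d ∷_) (choose d j)) (length-choose d j)) (length-choose d (suc j)))
         (nCk+nC[k+1]≡[n+1]C[k+1] d j))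

choose-sound : ∀ d j {I} → I ∈ˡ choose d j → length I ≡ j × Decreasing I × All (d >_) I
choose-sound d       zero    (here refl) = refl , [] , []
choose-sound (suc d) (suc j) I∈ with ∈-++⁻ (map (d ∷_) (choose d j)) I∈
... | inj₂ I∈′ = let len , D , I< = choose-sound d (suc j) I∈′
                 in len , D , All.map (λ i<d → ≤-trans i<d (n≤1+n d)) I<
... | inj₁ I∈′ with ∈-map⁻ (d ∷_) I∈′
...   | J , J∈ , refl = let len , D , J< = choose-sound d j J∈
                        in cong suc len , J< ∷ D , ≤-refl ∷ All.map (λ i<d → ≤-trans i<d (n≤1+n d)) J<

-- A set of at most `j` levels is padded to exactly `j` levels, which is possible because `j ≤ d`.
choose-complete : ∀ d j {P : Pred ℕ ℓ} (P? : Decidable P) → length (filter P? (downFrom d)) ≤ j → j ≤ d →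
                  ∃ λ I → I ∈ˡ choose d j × (∀ {i} → i < d → P i → i ∈ˡ I)
choose-complete d zero P? few _ = [] , here refl , λ i<d p →
  contradiction (∈-filter⁺ P? (∈-downFrom⁺ i<d) p) (none (filter P? (downFrom d)) few)
  where
  none : ∀ xs → length xs ≤ 0 → ∀ {i : ℕ} → i ∉ˡ xs
  none [] _ ()
choose-complete (suc d) (suc j) {P} P? few (s≤s j≤d) = split (P? d) (suc j ≤? d)
  where
  extend : ∀ {i I} → i < suc d → (i < d → i ∈ˡ I) → i ∈ˡ d ∷ I
  extend (s≤s i≤d) rest with m≤n⇒m<n∨m≡n i≤d
  ... | inj₁ i<d  = there (rest i<d)
  ... | inj₂ refl = here refl

  include : length (filter P? (downFrom d)) ≤ j →
            ∃ λ I → I ∈ˡ choose (suc d) (suc j) × (∀ {i} → i < suc d → P i → i ∈ˡ I)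
  include few′ = let I , I∈ , hits = choose-complete d j P? few′ j≤d in
    d ∷ I , ∈-++⁺ˡ (∈-map⁺ (d ∷_) I∈) , λ i<1+d p → extend i<1+d (λ i<d → hits i<d p)

  split : Dec (P d) → Dec (suc j ≤ d) →
          ∃ λ I → I ∈ˡ choose (suc d) (suc j) × (∀ {i} → i < suc d → P i → i ∈ˡ I)
  split (yes pd) _ = include (≤-pred (≤-trans (≤-reflexive (sym (cong length (filter-accept P? pd)))) few))
  -- The levels below `d` are too few for the selection, so `d` is taken as padding.
  split (no ¬pd) (no j≮d) = include (≤-trans (length-filter P? (downFrom d))
    (≤-trans (≤-reflexive (length-downFrom d)) (≤-pred (≰⇒> j≮d))))
  split (no ¬pd) (yes j<d) =
    let I , I∈ , hits = choose-complete d (suc j) P? (≤-trans (≤-reflexive (sym (cong length (filter-reject P? ¬pd)))) few) j<d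
    in I , ∈-++⁺ʳ (map (d ∷_) (choose d j)) I∈ , λ i<1+d p → hits (≤∧≢⇒< (≤-pred i<1+d) (λ { refl → ¬pd p })) p

cov-list : ∀ {k} {G : Graph n} {E : A → Fin n → Fin n → Set} {N} xs → (∀ {x} → x ∈ˡ xs → Cov k G (E x) N) →
           Cov k G (λ u v → Any (λ x → E x u v) xs) (length xs * N)
cov-list []       c = cov-none λ ()
cov-list {E = E} (x ∷ xs) c = cov-⊆ split ≤-refl (cov-∪ (c (here refl)) (cov-list xs (c ∘ there)))
  where
  split : ∀ {u v} → Any (λ x → E x u v) (x ∷ xs) → E x u v ⊎ Any (λ x → E x u v) xs
  split (here e)  = inj₁ e
  split (there e) = inj₂ e

-- Evaluating the number of forests

Σ<-cong : ∀ m {f h : ℕ → ℕ} → (∀ i → i < m → f i ≡ h i) → Σ< m f ≡ Σ< m h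
Σ<-cong zero    eq = refl
Σ<-cong (suc m) eq = cong₂ _+_ (Σ<-cong m λ i i<m → eq i (≤-trans i<m (n≤1+n m))) (eq m ≤-refl)

Σ<-affine : ∀ k m (w f : ℕ → ℕ) → Σ< m (λ i → w i + (k * f i + k * f i)) ≡ Σ< m w + (k * Σ< m f + k * Σ< m f)
Σ<-affine k zero    w f = subst (λ z → 0 ≡ z + z) (sym (ℕ.*-zeroʳ k)) refl
Σ<-affine k (suc m) w f = trans (cong (_+ (w m + (k * f m + k * f m))) (Σ<-affine k m w f))
  (regroup k (Σ< m w) (Σ< m f) (w m) (f m))
  where
  regroup : ∀ k a b c e → a + (k * b + k * b) + (c + (k * e + k * e)) ≡ a + c + (k * (b + e) + k * (b + e))
  regroup = solve-∀

weighted : (ℕ → ℕ) → ℕ → ℕ → ℕ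
weighted w k d = Σ< d (λ β → w β * g k (d ∸ β))

Σ<-last : ∀ k (w : ℕ → ℕ) d → Σ< (suc d) (λ β → w β * g k (d ∸ β)) ≡ weighted w k d
Σ<-last k w d = trans (cong (weighted w k d +_)
  (trans (cong (λ h → w d * g k h) (ℕ.n∸n≡0 d)) (ℕ.*-zeroʳ (w d)))) (ℕ.+-identityʳ _)

-- The recurrence of `g` is applied term by term; the term `β = d` on the right vanishes since
-- `g k 0` is 0.
weighted-suc : ∀ w k d → weighted w k (suc d) ≡ Σ< (suc d) w + (k * weighted w k d + k * weighted w k d)
weighted-suc w k d = trans (Σ<-cong (suc d) expand)
  (trans (Σ<-affine k (suc d) w (λ β → w β * g k (d ∸ β)))
         (cong (λ z → Σ< (suc d) w + (k * z + k * z)) (Σ<-last k w d)))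
  where
  regroup : ∀ a b e → a * suc (b * e + b * e) ≡ a + (b * (a * e) + b * (a * e))
  regroup = solve-∀

  expand : ∀ β → β < suc d → w β * g k (suc d ∸ β) ≡ w β + (k * (w β * g k (d ∸ β)) + k * (w β * g k (d ∸ β)))
  expand β (s≤s β≤d) = trans (cong (λ h → w β * g k h) (ℕ.+-∸-assoc 1 β≤d)) (regroup (w β) k (g k (d ∸ β)))

total-suc : ∀ k d → total k (suc d) ≡ weighted id k (suc d) + weighted (λ _ → k) k d
total-suc k d = cong (weighted id k (suc d) +_) (Σ<-last k (λ _ → k) d)

total-suc-suc : ∀ k d → total k (suc (suc d)) ≡
                Σ< (suc (suc d)) id + suc d * k + (k * total k (suc d) + k * total k (suc d))
total-suc-suc k d = trans (total-suc k (suc d))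
  (trans (cong₂ _+_ (weighted-suc id k (suc d))
                    (trans (weighted-suc (λ _ → k) k d) (cong (_+ (k * W + k * W)) (Σ<-const (suc d) k))))
  (trans (regroup (Σ< (suc (suc d)) id) (suc d * k) k (weighted id k (suc d)) W)
         (cong (λ z → Σ< (suc (suc d)) id + suc d * k + (k * z + k * z)) (sym (total-suc k d)))))
  where
  W = weighted (λ _ → k) k d

  regroup : ∀ a b k x y → a + (k * x + k * x) + (b + (k * y + k * y)) ≡ a + b + (k * (x + y) + k * (x + y))
  regroup = solve-∀

n<2^n : ∀ n → suc n ≤ 2 ^ n
n<2^n zero    = ≤-refl
n<2^n (suc n) = ≤-trans (+-mono-≤ (ℕ.m^n>0 2 n) (n<2^n n))
  (≤-reflexive (cong (2 ^ n +_) (sym (ℕ.+-identityʳ (2 ^ n)))))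

Σ<-id≤2^ : ∀ m → Σ< (suc m) id ≤ 2 ^ m
Σ<-id≤2^ zero    = z≤n
Σ<-id≤2^ (suc m) = ≤-trans (+-mono-≤ (Σ<-id≤2^ m) (n<2^n m))
  (≤-reflexive (cong (2 ^ m +_) (sym (ℕ.+-identityʳ (2 ^ m)))))

-- As `p + p + 2kp = 2(k+1)p`, raising the factor from `2k` to `2(k+1)` pays for both additive
-- terms.
affine-≤ : ∀ k {a b c p} → a ≤ p → b ≤ p → c ≤ p → a + b + (k * c + k * c) ≤ 2 * suc k * p
affine-≤ k {p = p} a≤p b≤p c≤p =
  ≤-trans (+-mono-≤ (+-mono-≤ a≤p b≤p) (+-mono-≤ (ℕ.*-monoʳ-≤ k c≤p) (ℕ.*-monoʳ-≤ k c≤p)))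
          (≤-reflexive (regroup k p))
  where
  regroup : ∀ k p → p + p + (k * p + k * p) ≡ 2 * suc k * p
  regroup = solve-∀

total≤power : ∀ k d → total k d ≤ (2 * suc k) ^ d
total≤power k zero = z≤n
total≤power k (suc zero) = ≤-trans (≤-reflexive (ℕ.*-zeroʳ k)) z≤n
total≤power k (suc (suc d)) = ≤-trans (≤-reflexive (total-suc-suc k d))
  (affine-≤ k triangle linear (total≤power k (suc d)))
  where
  2≤2k : 2 ≤ 2 * suc k
  2≤2k = ℕ.*-monoʳ-≤ 2 (s≤s z≤n)

  triangle : Σ< (suc (suc d)) id ≤ (2 * suc k) ^ suc d
  triangle = ≤-trans (Σ<-id≤2^ (suc d)) (ℕ.^-monoˡ-≤ (suc d) 2≤2k)

  -- One factor `2 * suc k` of the power absorbs `k`, and the other `d` factors absorb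
  -- `suc d ≤ 2 ^ d`.
  linear : suc d * k ≤ (2 * suc k) ^ suc d
  linear = ≤-trans (ℕ.*-mono-≤ (≤-trans (n<2^n d) (ℕ.^-monoˡ-≤ d 2≤2k)) (≤-trans (n≤1+n k) (m≤m+n (suc k) _)))
    (≤-reflexive (ℕ.*-comm ((2 * suc k) ^ d) (2 * suc k)))

Σ<-id≡C : ∀ d → Σ< d id ≡ d C 2
Σ<-id≡C zero    = refl
Σ<-id≡C (suc d) = trans (cong₂ _+_ (Σ<-id≡C d) (sym (nC1≡n d)))
  (trans (ℕ.+-comm (d C 2) (d C 1)) (nCk+nC[k+1]≡[n+1]C[k+1] d 1))

-- For `k = 0` only the triangular number survives in the recurrence.
total₀≡C : ∀ d → total 0 d ≡ d C 2
total₀≡C zero          = refl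
total₀≡C (suc zero)    = refl
total₀≡C (suc (suc d)) = trans (total-suc-suc 0 d)
  (trans (ℕ.+-identityʳ _) (trans (cong (Σ< (suc (suc d)) id +_) (ℕ.*-zeroʳ (suc d)))
  (trans (ℕ.+-identityʳ _) (Σ<-id≡C (suc (suc d))))))

-- Bounds on the strong induced arboricity

f≤ : ∀ {k} (G : Graph n) {N} → Cov k G (Valid k G) N → f k G ≤ N
f≤ {k = k} G (cov Fs len strong covers) = ≤-trans
  (proj₂ (f-isMinimum k G) (length Fs) (Vec.fromList Fs , vec-all strong ,
    λ u v valid → vec-any (Any.map (λ (u∈ , v∈) → edge valid , u∈ , v∈) (covers valid))))
  len
  where
  edge : ∀ {u v} → Valid k G u v → Adj G u v
  edge (_ , _ , uv , _) = uv

  vec-all : ∀ {P : Pred (Subset _) _} {xs} → All P xs → VecAll.All P (Vec.fromList xs)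
  vec-all []       = VecAll.[]
  vec-all (p ∷ ps) = p VecAll.∷ vec-all ps

  vec-any : ∀ {P : Pred (Subset _) _} {xs} → Any P xs → VecAny.Any P (Vec.fromList xs)
  vec-any (here p)  = VecAny.here p
  vec-any (there p) = VecAny.there (vec-any p)

module Bounds (G : Graph n) {d : ℕ} (L : Layering G (V G) d) where
  open Layering L
  open Restrict L

  -- Adjacent vertices lie on different levels and validity is symmetric, so each edge may be read
  -- with its deeper end second.
  cov-oriented : ∀ {k N} → Cov k G (λ u v → level u < level v × Valid k G u v) N → Cov k G (Valid k G) N
  cov-oriented (cov Fs len strong covers) = cov Fs len strong λ valid@(F , F-strong , uv , u∈ , v∈) →
    case adjacent (proj₁ (Adj⇒∈V G uv)) (proj₂ (Adj⇒∈V G uv)) uv of λ where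
      (inj₁ (u<v , _)) → covers (u<v , valid)
      (inj₂ (v<u , _)) → Any.map Product.swap (covers (v<u , F , F-strong , symm G uv , v∈ , u∈))

  f≤total : ∀ k → f (suc k) G ≤ total k d
  f≤total k = f≤ G (cov-oriented (cov-⊆ place ≤-refl (Counting.cov-layered G (V G) d L k)))
    where
    place : ∀ {u v} → level u < level v × Valid (suc k) G u v → level u < level v × ∃ λ xs →
            Grown G u v xs × suc (suc k) ≤ length xs × All (_∈ V G) xs
    place (u<v , valid) = let xs , t , len = valid⇒grown G (s≤s z≤n) valid
                          in u<v , xs , t , ≤-reflexive (sym len) , grown-∈V t

  f≤choose : ∀ k → suc (suc k) ≤ d → f (suc k) G ≤ (d C suc (suc k)) * total k (suc (suc k))
  f≤choose k k+1<d = f≤ G (cov-oriented (cov-⊆ place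
    (≤-reflexive (cong (_* total k (suc (suc k))) (length-choose d (suc (suc k)))))
    (cov-list {E = Within} (choose d (suc (suc k))) cover)))
    where
    Within : List ℕ → Fin _ → Fin _ → Set
    Within I u v = rank I (level u) < rank I (level v) × ∃ λ xs →
      Grown G u v xs × suc (suc k) ≤ length xs × All (_∈ onLevels I) xs

    cover : ∀ {I} → I ∈ˡ choose d (suc (suc k)) → Cov (suc k) G (Within I) (total k (suc (suc k)))
    cover {I} I∈ with choose-sound d (suc (suc k)) I∈
    ... | len , D , _ = cov-⊆ id (≤-reflexive (cong (total k) len))
                              (Counting.cov-layered G (onLevels I) (length I) (restrict D) k)

    place : ∀ {u v} → level u < level v × Valid (suc k) G u v → Any (λ I → Within I u v) (choose d (suc (suc k)))
    place (u<v , valid) with valid⇒grown G (s≤s z≤n) valid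
    ... | xs , t , len
      -- The tree has `suc (suc k)` vertices, so some selection of that many levels contains all
      -- levels it meets.
      with choose-complete d (suc (suc k)) (λ i → Any.any? (i ℕ.≟_) (map level xs))
             (≤-trans (Unique-⊆⇒length≤ (Unique.filter⁺ _ (Unique.downFrom⁺ d))
                (λ i∈ → proj₂ (∈-filter⁻ (λ i → Any.any? (i ℕ.≟_) (map level xs)) {xs = downFrom d} i∈)))
               (≤-reflexive (trans (length-map level xs) len))) k+1<d
    ...   | I , I∈ , hits = lose I∈
      (rank-mono (proj₁ (proj₂ (choose-sound d (suc (suc k)) I∈))) (hit (grown-u t)) u<v ,
       xs , t , ≤-reflexive (sym len) ,
       All.tabulate λ x∈ → ∈-⟪⟫⁺ (onLevels? I) (All.lookup (grown-∈V t) x∈ , hit x∈))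
      where
      hit : ∀ {x} → x ∈ˡ xs → level x ∈ˡ I
      hit x∈ = hits (level< (All.lookup (grown-∈V t) x∈)) (∈-map⁺ level x∈)

theorem6 : ∀ (k d : ℕ) → 1 ≤ k → 1 ≤ d →
    ∀ {n : ℕ} (G : Graph n) → HasTreeDepth G d →
    (f k G ≤ (2 * k) ^ d) ×
    (k + 1 ≤ d → f k G ≤ (2 * k) ^ (k + 1) * (d C (k + 1))) ×
    (f 1 G ≤ d C 2)
theorem6 (suc k) d _ _ G td =
  ≤-trans (f≤total k) (total≤power k d) ,
  few-levels ,
  ≤-trans (f≤total 0) (≤-reflexive (total₀≡C d))
  where
  open Bounds G (treeDepth⇒layering G td)

  few-levels : suc k + 1 ≤ d → f (suc k) G ≤ (2 * suc k) ^ (suc k + 1) * (d C (suc k + 1))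
  few-levels k+1<d =
    subst (λ j → f (suc k) G ≤ (2 * suc k) ^ j * (d C j)) (ℕ.+-comm 1 (suc k))
      (≤-trans (f≤choose k (subst (_≤ d) (ℕ.+-comm (suc k) 1) k+1<d))
        (≤-trans (ℕ.*-monoʳ-≤ (d C suc (suc k)) (total≤power k (suc (suc k))))
                 (≤-reflexive (ℕ.*-comm (d C suc (suc k)) _))))
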